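{- Let $\ell\ge3$ and $0\le i<\ell$. Regularization commutes with the crystal operators: as maps on the nodes of $B(\Lambda_0)^L$ (with the convention $\mathcal R(0)=0$), 1. $\mathcal R\circ\widehat f_i=\widetilde f_i\circ\mathcal R$; 2. $\mathcal R\circ\widehat e_i=\widetilde e_i\circ\mathcal R$.
   Context: The position $(a,b)$ (row $a$, rows numbered downward; column $b$) has residue $b-a\bmod\ell$. The ladder of $(a,b)$ is the set of positions $(c,d)$, $c,d\ge1$, with $c-a=(\ell-1)(b-d)$; all its positions have the same residue, and it is an $i$-ladder if that residue is $i$. Ladders are ordered left to right, i.e. by increasing value of $a+(\ell-1)(b-1)$. The regularization $\mathcal R\lambda$ of a partition $\lambda$ is the ($\ell$-regular) partition obtained by moving all boxes of $\lambda$ up to the top of their respective ladders. A partition is $\ell$-regular if it does not have $\ell$ or more equal nonzero parts. A box of $\lambda$ of residue $i$ whose removal leaves a partition is a removable $i$-box (marked $-$); a position of residue $i$ not in $\lambda$ whose addition gives a partition is an addable $i$-box (marked $+$). Classical crystal $B(\Lambda_0)$ on $\ell$-regular partitions: the $i$-signature is the word of $+$'s and $-$'s read from the bottom row to the top row; after repeatedly deleting adjacent pairs $-+$ one gets $+\cdots+-\cdots-$. $\widetilde f_i\lambda$ adds the box of the rightmost remaining $+$ and $\widetilde e_i\lambda$ removes the box of the leftmost remaining $-$ (the result is $0$ if there is no such sign). Ladder crystal: the ladder $i$-signature of a partition is the word of $+$'s and $-$'s read from leftmost to rightmost $i$-ladder, and from top to bottom on each ladder; again repeatedly delete adjacent pairs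 $-+$. $\widehat f_i\lambda$ adds the box of the rightmost remaining $+$ and $\widehat e_i\lambda$ removes the box of the leftmost remaining $-$ (the result is $0$ if there is no such sign). The nodes of $B(\Lambda_0)^L$ are the partitions obtained from the empty partition $\emptyset$ by applying finite sequences of the operators $\widehat f_i$, $0\le i<\ell$. -}

module Defs where

open import Data.Integer.Base as ℤ using (+_; _%ℕ_)
open import Data.List.Base
  using (List; []; _∷_; map; filter; length; upTo; downFrom; head; last;
         foldr; concatMap; mapMaybe; cartesianProduct)
open import Data.List.Relation.Unary.All as All using (All)
open import Data.List.Relation.Unary.Linked as Linked using (Linked)
open import Data.Maybe.Base as Maybe using (Maybe; just; nothing)
open import Data.Nat.Base
  using (ℕ; zero; suc; pred; _+_; _*_; _∸_; _<_; _≥_; NonZero)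
open import Data.Nat.ListAction using (sum)
open import Data.Nat.Properties using (_≟_; _<?_; _≥?_)
open import Data.Product.Base using (_×_; _,_; proj₁; proj₂)
open import Data.Sign.Base as Sign using (Sign)
open import Data.Sign.Properties using () renaming (_≟_ to _≟ˢ_)
open import Relation.Binary.PropositionalEquality.Core using (_≡_)
open import Relation.Nullary.Decidable using (Dec; yes; no; _×-dec_)

-- A partition is the list of its nonzero parts, largest first, so that
-- propositional equality of lists is equality of partitions.

IsPartition : List ℕ → Set
IsPartition μ = Linked _≥_ μ × All (0 <_) μ

isPartition? : (μ : List ℕ) → Dec (IsPartition μ)
isPartition? μ = Linked.linked? _≥?_ μ ×-dec All.all? (0 <?_) μ

-- Positions are (row , column), rows numbered downward, both counted from 0
-- rather than from 1.  Residues b - a are unaffected by this shift.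

Position : Set
Position = ℕ × ℕ

rowLength : List ℕ → ℕ → ℕ
rowLength []      _       = 0
rowLength (x ∷ μ) zero    = x
rowLength (x ∷ μ) (suc a) = rowLength μ a

_∈Diagram_ : Position → List ℕ → Set
(a , b) ∈Diagram μ = b < rowLength μ a

_∈Diagram?_ : (p : Position) (μ : List ℕ) → Dec (p ∈Diagram μ)
(a , b) ∈Diagram? μ = b <? rowLength μ a

-- Every box (a , b) of a partition μ satisfies a < length μ and b < sum μ.

boxes : List ℕ → List Position
boxes μ = filter (_∈Diagram? μ) (cartesianProduct (upTo (length μ)) (upTo (sum μ)))

consTrimmed : ℕ → List ℕ → List ℕ
consTrimmed zero [] = []
consTrimmed x    μ  = x ∷ μ

trimZeros : List ℕ → List ℕ
trimZeros = foldr consTrimmed []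

-- Adding a box at the end of row a.  The result need not be a partition: zero
-- rows are inserted if row a lies beyond the first empty row.

addToRow : ℕ → List ℕ → List ℕ
addToRow zero    []      = 1 ∷ []
addToRow (suc a) []      = 0 ∷ addToRow a []
addToRow zero    (x ∷ μ) = suc x ∷ μ
addToRow (suc a) (x ∷ μ) = x ∷ addToRow a μ

-- Removing the last box of row a.  Only trailing empty rows are discarded, so
-- emptying a row that has a nonempty row below it does not give a partition.

decrementRow : ℕ → List ℕ → List ℕ
decrementRow _       []      = []
decrementRow zero    (x ∷ μ) = pred x ∷ μ
decrementRow (suc a) (x ∷ μ) = x ∷ decrementRow a μ

removeFromRow : ℕ → List ℕ → List ℕ
removeFromRow a μ = trimZeros (decrementRow a μ)

-- A position whose addition (removal) gives a partition is necessarily the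
-- first one after (the last one in) its row.

Addable : List ℕ → Position → Set
Addable μ (a , b) = b ≡ rowLength μ a × IsPartition (addToRow a μ)

addable? : (μ : List ℕ) (p : Position) → Dec (Addable μ p)
addable? μ (a , b) = (b ≟ rowLength μ a) ×-dec isPartition? (addToRow a μ)

Removable : List ℕ → Position → Set
Removable μ (a , b) = suc b ≡ rowLength μ a × IsPartition (removeFromRow a μ)

removable? : (μ : List ℕ) (p : Position) → Dec (Removable μ p)
removable? μ (a , b) = (suc b ≟ rowLength μ a) ×-dec isPartition? (removeFromRow a μ)

Word : Set
Word = List (Sign × Position)

push : Sign × Position → Word → Word
push (Sign.- , _) ((Sign.+ , _) ∷ w) = w
push x            w                  = x ∷ w

-- Deletes adjacent pairs - + until none is left, working from the right end of
-- the word; the surviving letters do not depend on the order of the deletions.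

cancel : Word → Word
cancel = foldr push []

positionsWithSign : Sign → Word → List Position
positionsWithSign s w = map proj₂ (filter (λ x → proj₁ x ≟ˢ s) w)

-- The operators attached to a signature; nothing plays the role of 0.

addGoodBox : Word → List ℕ → Maybe (List ℕ)
addGoodBox w μ =
  Maybe.map (λ p → addToRow (proj₁ p) μ) (last (positionsWithSign Sign.+ (cancel w)))

removeGoodBox : Word → List ℕ → Maybe (List ℕ)
removeGoodBox w μ =
  Maybe.map (λ p → removeFromRow (proj₁ p) μ) (head (positionsWithSign Sign.- (cancel w)))

module _ (ℓ : ℕ) where

  -- (c , d) lies on the ladder of (a , b), that is c - a = (ℓ - 1)(b - d),
  -- precisely when both have the same ladder number.

  ladder : Position → ℕ
  ladder (a , b) = a + (ℓ ∸ 1) * b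

  ladderSize : List ℕ → ℕ → ℕ
  ladderSize μ k = length (filter (λ p → ladder p ≟ k) (boxes μ))

  -- Only the part of the ladder, from top to bottom, inside a rectangle that
  -- contains all addable and removable positions of μ.

  positionsOnLadder : List ℕ → ℕ → List Position
  positionsOnLadder μ k =
    filter (λ p → ladder p ≟ k)
           (cartesianProduct (upTo (suc (length μ))) (upTo (suc (sum μ))))

  -- The number of positions on the ladder of p lying strictly above p; their
  -- columns are at most ladder p as soon as ℓ ≥ 2.

  positionsAbove : Position → ℕ
  positionsAbove p =
    length (filter (λ q → ladder q ≟ ladder p)
                   (cartesianProduct (upTo (proj₁ p)) (upTo (suc (ladder p)))))

  -- The boxes obtained from those of μ by moving them up to the top of their
  -- ladders.

  _∈Regularized_ : Position → List ℕ → Set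
  p ∈Regularized μ = positionsAbove p < ladderSize μ (ladder p)

  _∈Regularized?_ : (p : Position) (μ : List ℕ) → Dec (p ∈Regularized μ)
  p ∈Regularized? μ = positionsAbove p <? ladderSize μ (ladder p)

  regularizedRow : List ℕ → ℕ → ℕ
  regularizedRow μ a = length (filter (λ b → (a , b) ∈Regularized? μ) (upTo (sum μ)))

  -- The row lengths of the set of moved boxes.  Boxes only move upward, so the
  -- rows from length μ on are empty; a box (a , b) of μ has a + b < sum μ, so for
  -- ℓ ≥ 2 its ladder only meets columns smaller than sum μ.

  ℛ : List ℕ → List ℕ
  ℛ μ = trimZeros (map (regularizedRow μ) (upTo (length μ)))

  module _ .{{_ : NonZero ℓ}} where

    residue : Position → ℕ
    residue (a , b) = (+ b ℤ.- + a) %ℕ ℓ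

    mark : ℕ → List ℕ → Position → Maybe (Sign × Position)
    mark i μ p with residue p ≟ i | addable? μ p | removable? μ p
    ... | no  _ | _     | _     = nothing
    ... | yes _ | yes _ | _     = just (Sign.+ , p)
    ... | yes _ | no  _ | yes _ = just (Sign.- , p)
    ... | yes _ | no  _ | no  _ = nothing

    -- All addable and removable positions (a , b) of μ satisfy a ≤ length μ and
    -- b ≤ sum μ.  Below, the rows run from bottom to top; a row contains at most
    -- one sign when ℓ ≥ 2.

    signature : ℕ → List ℕ → Word
    signature i μ =
      mapMaybe (mark i μ) (cartesianProduct (downFrom (suc (length μ))) (upTo (suc (sum μ))))

    -- Ladders from left to right, each from top to bottom.  An addable or
    -- removable position has a + b ≤ sum μ, hence ladder number at most
    -- ℓ * sum μ when ℓ ≥ 2.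

    ladderSignature : ℕ → List ℕ → Word
    ladderSignature i μ =
      mapMaybe (mark i μ) (concatMap (positionsOnLadder μ) (upTo (suc (ℓ * sum μ))))

    f̃ ẽ f̂ ê : ℕ → List ℕ → Maybe (List ℕ)
    f̃ i μ = addGoodBox    (signature i μ) μ
    ẽ i μ = removeGoodBox (signature i μ) μ
    f̂ i μ = addGoodBox    (ladderSignature i μ) μ
    ê i μ = removeGoodBox (ladderSignature i μ) μ

    -- The nodes of B(Λ₀)^L.

    data LadderNode : List ℕ → Set where
      ∅    : LadderNode []
      step : ∀ {i μ ν} → i < ℓ → LadderNode μ → f̂ i μ ≡ just ν → LadderNode ν

{-# OPTIONS --safe #-}

-- Write ℓ = m + 1, let L (a , b) = a + m * b be the ladder number, and label a
-- plus at p by L p and a minus at p by L p + ℓ, the next ladder of its residue.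
--
-- Along a ladder, the numbers of row ends telescope, so for every label the
-- difference between the number of pluses and the number of minuses depends on
-- the ladder sizes alone.  If in addition a signature is sorted by label, minuses
-- first, then its cancelled word is determined, up to labels, by these differences.
-- Regularization preserves the ladder sizes, so it remains to sort both signatures.
-- For a regular partition read by rows this holds because its boxes fill the tops
-- of the ladders.  For a node of the ladder crystal it amounts to no minus lying
-- above a plus on a ladder, which follows from the invariant Locked: no hook length
-- is ℓ times the arm length.  Finally, the good boxes of μ and of ℛ μ lie on the
-- same ladder, and a regular partition is determined by its ladder sizes.

module Submission where

open import Defs
open import Data.Empty using (⊥; ⊥-elim)
open import Data.Integer.Base as ℤ using (_%ℕ_; _/ℕ_) renaming (+_ to pos)
import Data.Integer.Properties as ℤ
import Data.Integer.Tactic.RingSolver as ℤ-Solver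
open import Data.Integer.DivMod using (a≡a%ℕn+[a/ℕn]*n; n%ℕd<d)
open import Data.Integer.Divisibility.Signed using (∣⇒∣ᵤ) renaming (divides to dividesℤ)
open import Data.List.Base as List
  using (List; []; _∷_; _++_; _∷ʳ_; filter; length; foldr; replicate; head; last; initLast; _∷ʳ′_;
         upTo; applyUpTo; downFrom; cartesianProduct; mapMaybe; concatMap)
open import Data.List.Membership.Propositional using (_∈_)
open import Data.List.Membership.Propositional.Properties
  using (∈-++⁺ʳ; ∈-++⁻; ∈-applyUpTo⁺; ∈-applyUpTo⁻; ∈-filter⁺; ∈-filter⁻; ∈-map⁺; ∈-map⁻; ∈-upTo⁺; ∈-upTo⁻;
         ∈-downFrom⁺; ∈-concat⁺′; ∈-cartesianProduct⁺; ∈-cartesianProduct⁻)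
open import Data.List.Membership.Propositional.Properties.WithK using (unique∧set⇒bag)
open import Data.List.Properties
  using (last-map; head-map; map-∘; filter-accept; filter-reject; ++-assoc; ∷-injectiveʳ; map-upTo;
      length-map; length-applyUpTo)
open import Data.List.Relation.Binary.BagAndSetEquality using (∼bag⇒↭)
open import Data.List.Relation.Binary.Permutation.Propositional.Properties using (↭-length)
open import Data.List.Relation.Unary.All as All using (All; []; _∷_)
import Data.List.Relation.Unary.All.Properties as All
open import Data.List.Relation.Unary.AllPairs as AllPairs using (AllPairs; []; _∷_)
import Data.List.Relation.Unary.AllPairs.Properties as AllPairs
open import Data.List.Relation.Unary.Any using (here; there)
open import Data.List.Relation.Unary.Linked using (Linked; []; [-]; _∷_)
open import Data.List.Relation.Unary.Unique.Propositional using (Unique)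
import Data.List.Relation.Unary.Unique.Propositional.Properties as Unique
open import Data.Maybe.Base as Maybe using (Maybe; just; nothing; map)
open import Data.Maybe.Properties using (just-injective)
open import Data.Nat.Base
  using (ℕ; zero; suc; pred; _+_; _*_; _∸_; _≤_; _<_; _≥_; z≤n; s≤s; s≤s⁻¹; NonZero; _%_; _/_; >-nonZero⁻¹)
open import Data.Nat.DivMod using (m≡m%n+[m/n]*n; m%n<n; [m+kn]%n≡m%n; m<n⇒m%n≡m)
open import Data.Nat.Divisibility using (_∣_; ∣m+n∣m⇒∣n; n∣n; ∣⇒≤; ∣m∣n⇒∣m+n)
open import Data.Nat.ListAction using (sum)
open import Data.Nat.Properties as ℕ
  using (_≟_; _<?_; _≤?_; ≤-refl; ≤-trans; ≤-reflexive; <-≤-trans; ≤-<-trans; <⇒≤)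
open import Data.Nat.Tactic.RingSolver using (solve-∀)
open import Data.Product.Base using (∃; ∃₂; _×_; _,_; proj₁; proj₂)
open import Data.Product.Properties using (≡-dec)
open import Data.Sign.Base as Sign using (Sign)
open import Data.Sign.Properties using () renaming (_≟_ to _≟ˢ_)
open import Data.Sum.Base using (_⊎_; inj₁; inj₂)
open import Function.Base using (_∘_)
open import Function.Bundles using (mk⇔)
open import Relation.Binary.Definitions using (tri<; tri≈; tri>)
open import Relation.Binary.PropositionalEquality
  using (_≡_; _≢_; refl; sym; trans; cong; cong₂; subst; module ≡-Reasoning)
open import Relation.Nullary.Decidable using (Dec; yes; no; _×-dec_)
open import Relation.Nullary.Negation using (¬_; contradiction)
open import Relation.Unary using (Decidable)

-- The shift of the minus labels by ℓ comes from the local shape of a diagram. At a position (a , b)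
-- with a and b positive, compare an addable position there with a removable box at (a - 1 , b - 1):
-- the difference of their indicators is the indicator of row a having length b minus that of row a
-- - 1 having length b. The diagonal step between the two corners raises the ladder number by
-- exactly ℓ. `Locked` is a statement about hooks. If (a , c) ends its row and h is the last row of
-- column b, then L (a , c) = L (h + 1 , b) means m (c - b) = h + 1 - a, so the hook length arm +
-- leg + 1 is arm + m arm = ℓ arm. It constrains all rows and columns and not only the corners of
-- one residue, so it can be carried through operators of varying residue. A forbidden hook created
-- by a new box is traced back to a forbidden hook of the old diagram, or to a plus that would have
-- outlived the one chosen.

pattern plus  = Sign.+
pattern minus = Sign.-

-- Cancellation and the neighbours of the good signs.

plusses minusses : Word → List Position
plusses  = positionsWithSign plus
minusses = positionsWithSign minus

StartsWithPlus : Word → Set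
StartsWithPlus w = ∃₂ λ q w′ → w ≡ (plus , q) ∷ w′

EndsWithMinus : Word → Set
EndsWithMinus w = ∃₂ λ w′ q → w ≡ w′ ∷ʳ (minus , q)

-- Only the immediate neighbours of a good sign matter. A plus right after a surviving plus survives
-- too, so the last surviving plus has none right after it; symmetrically, no minus stands right
-- before the first surviving minus. The last clause of `FirstMinus` strengthens the induction in
-- `first-minus`.
LastPlus FirstMinus : Word → Position → Set
LastPlus   w p = ∃₂ λ u v → w ≡ u ++ (plus , p) ∷ v × ¬ StartsWithPlus v
FirstMinus w p = ∃₂ λ u v → w ≡ u ++ (minus , p) ∷ v × ¬ EndsWithMinus u × ¬ StartsWithPlus (cancel v)

last-plus : ∀ w {p} → last (plusses (cancel w)) ≡ just p → LastPlus w p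
last-plus ((minus , q) ∷ w) eq = go (cancel w) refl eq
  where
  extend : ∀ {p} → last (plusses (cancel w)) ≡ just p → LastPlus ((minus , q) ∷ w) p
  extend eq′ with u , v , refl , v-ok ← last-plus w eq′ = (minus , q) ∷ u , v , refl , v-ok
  go : ∀ c {p} → cancel w ≡ c → last (plusses (push (minus , q) c)) ≡ just p → LastPlus ((minus , q) ∷ w) p
  go []                eq′ ()
  go ((minus , _) ∷ c) eq′ h = extend (trans (cong (last ∘ plusses) eq′) h)
  go ((plus , r) ∷ c)  eq′ h = extend (trans (cong (last ∘ plusses) eq′) (last-∷ (plusses c) h))
    where
    last-∷ : ∀ {y : Position} xs {p} → last xs ≡ just p → last (y ∷ xs) ≡ just p
    last-∷ (x ∷ xs) h = h
last-plus ((plus , q) ∷ w) eq = go (plusses (cancel w)) refl eq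
  where
  start-survives : StartsWithPlus w → plusses (cancel w) ≢ []
  start-survives (_ , _ , refl) ()
  go : ∀ ps {p} → plusses (cancel w) ≡ ps → last (q ∷ ps) ≡ just p → LastPlus ((plus , q) ∷ w) p
  go []       eq′ refl = [] , w , refl , λ s → start-survives s eq′
  go (p ∷ ps) eq′ h with u , v , refl , v-ok ← last-plus w (trans (cong last eq′) h) =
    (plus , q) ∷ u , v , refl , v-ok

first-minus : ∀ w {p} → head (minusses (cancel w)) ≡ just p → FirstMinus w p
first-minus ((plus , q) ∷ w) eq with u , v , refl , u-ok , v-ok ← first-minus w eq =
  (plus , q) ∷ u , v , refl , extend , v-ok
  where
  extend : ¬ EndsWithMinus ((plus , q) ∷ u)
  extend ([]    , _ , ())
  extend (_ ∷ w′ , r , h) = u-ok (w′ , r , ∷-injectiveʳ h)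
first-minus ((minus , q) ∷ w) eq = go (cancel w) refl eq
  where
  no-start : ∀ {x c} → cancel w ≡ x ∷ c → proj₁ x ≡ minus → ¬ StartsWithPlus (cancel w)
  no-start eq′ refl (_ , _ , h) with () ← trans (sym eq′) h
  nil-ends : ¬ EndsWithMinus []
  nil-ends ([]    , _ , ())
  nil-ends (_ ∷ _ , _ , ())
  push-minus : ∀ {p} c → ¬ StartsWithPlus c → push (minus , p) c ≡ (minus , p) ∷ c
  push-minus []                _  = refl
  push-minus ((minus , _) ∷ _) _  = refl
  push-minus ((plus , r) ∷ c)  ok = ⊥-elim (ok (r , c , refl))
  go : ∀ c {p} → cancel w ≡ c → head (minusses (push (minus , q) c)) ≡ just p → FirstMinus ((minus , q) ∷ w) p
  go []                eq′ refl = [] , w , refl , nil-ends , λ (_ , _ , h) → contradiction (trans (sym eq′) h) λ ()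
  go ((minus , _) ∷ _) eq′ refl = [] , w , refl , nil-ends , no-start eq′ refl
  go ((plus , r) ∷ c)  eq′ h with first-minus w (trans (cong (head ∘ minusses) eq′) h)
  -- Here the surviving minus would directly follow the minus `q`. As `cancel v` does not start with
  -- a plus, that minus would head `cancel w`, where in fact the plus deleting `q` stands.
  ... | []    , v , refl , _ , v-ok with () ← trans (sym (push-minus (cancel v) v-ok)) eq′
  ... | y ∷ u , v , refl , u-ok , v-ok = (minus , q) ∷ y ∷ u , v , refl , extend , v-ok
    where
    extend : ¬ EndsWithMinus ((minus , q) ∷ y ∷ u)
    extend ([]    , _ , ())
    extend (_ ∷ w′ , r , h′) = u-ok (w′ , r , ∷-injectiveʳ h′)

-- Cancellation of sorted words of labelled signs.

-- Signs carrying a label instead of a position, ordered by label and, for equal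
-- labels, with the minuses first.

Letter : Set
Letter = Sign × ℕ

_≟ᴸ_ : (x y : Letter) → _
_≟ᴸ_ = ≡-dec _≟ˢ_ _≟_

data _⊑_ : Letter → Letter → Set where
  label< : ∀ {s t g h} → g < h → (s , g) ⊑ (t , h)
  minus≤ : ∀ {t g} → (minus , g) ⊑ (t , g)
  plus≤  : ∀ {g} → (plus , g) ⊑ (plus , g)

⊑-label : ∀ {x y} → x ⊑ y → proj₂ x ≤ proj₂ y
⊑-label (label< g<h) = <⇒≤ g<h
⊑-label minus≤       = ≤-refl
⊑-label plus≤        = ≤-refl

plus⊑minus : ∀ {g h} → (plus , g) ⊑ (minus , h) → g < h
plus⊑minus (label< g<h) = g<h

count : Letter → List Letter → ℕ
count x = length ∘ filter (_≟ᴸ x)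

count-hit : ∀ x w → count x (x ∷ w) ≡ suc (count x w)
count-hit x w = cong length (filter-accept (_≟ᴸ x) {xs = w} refl)

count-miss : ∀ {x} y w → y ≢ x → count x (y ∷ w) ≡ count x w
count-miss {x} y w y≢x = cong length (filter-reject (_≟ᴸ x) {xs = w} y≢x)

block : ℕ → ℕ → ℕ → List Letter
block g m p = replicate m (minus , g) ++ replicate p (plus , g)

-- `cancel` never looks at the positions of a word, so the label travels in a dummy position and no
-- second notion of cancellation is required.
embed : List Letter → Word
embed = List.map λ (s , g) → s , (g , 0)

count-absent : ∀ {x} {w} → All (x ≢_) w → count x w ≡ 0
count-absent []         = refl
count-absent {w = y ∷ w} (x≢y ∷ ps) = trans (count-miss y w (x≢y ∘ sym)) (count-absent ps)

record Split (g : ℕ) (w : List Letter) : Set where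
  constructor split
  field
    m p     : ℕ
    rest    : List Letter
    w≡      : w ≡ block g m p ++ rest
    above   : All (λ x → g < proj₂ x) rest
    sorted  : AllPairs _⊑_ rest

splitSorted : ∀ g {w} → AllPairs _⊑_ w → All (λ x → g ≤ proj₂ x) w → Split g w
splitSorted g []       []       = split 0 0 [] refl [] []
splitSorted g {(s , h) ∷ w} (x⊑ ∷ w-sorted) (g≤h ∷ g≤) with h ≟ g
... | no h≢g = split 0 0 _ refl
  (ℕ.≤∧≢⇒< g≤h (h≢g ∘ sym) ∷ All.map (λ x⊑y → <-≤-trans (ℕ.≤∧≢⇒< g≤h (h≢g ∘ sym)) (⊑-label x⊑y)) x⊑)
  (x⊑ ∷ w-sorted)
splitSorted g {(s , h) ∷ w} (x⊑ ∷ w-sorted) (g≤h ∷ g≤) | yes refl with splitSorted g w-sorted g≤ | s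
... | split m p rest refl above sorted | minus = split (suc m) p rest refl above sorted
... | split zero p rest refl above sorted | plus = split 0 (suc p) rest refl above sorted
... | split (suc m) p rest refl above sorted | plus = ⊥-elim (ℕ.<-irrefl refl (plus⊑minus (All.head x⊑)))

count-block-minus : ∀ g m p w → count (minus , g) (block g m p ++ w) ≡ m + count (minus , g) w
count-block-minus g (suc m) p w = trans (count-hit _ (block g m p ++ w)) (cong suc (count-block-minus g m p w))
count-block-minus g zero (suc p) w = trans (count-miss (plus , g) (block g 0 p ++ w) λ ())
    (count-block-minus g zero p w)
count-block-minus g zero zero w = refl

count-block-plus : ∀ g m p w → count (plus , g) (block g m p ++ w) ≡ p + count (plus , g) w
count-block-plus g (suc m) p w = trans (count-miss (minus , g) (block g m p ++ w) λ ()) (count-block-plus g m p w)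
count-block-plus g zero (suc p) w = trans (count-hit _ (block g 0 p ++ w)) (cong suc (count-block-plus g zero p w))
count-block-plus g zero zero w = refl

count-block-other : ∀ {x g} → proj₂ x ≢ g → ∀ m p w → count x (block g m p ++ w) ≡ count x w
count-block-other {x} {g} x≢g (suc m) p w =
  trans (count-miss (minus , g) (block g m p ++ w) (x≢g ∘ sym ∘ cong proj₂)) (count-block-other x≢g m p w)
count-block-other {x} {g} x≢g zero (suc p) w =
  trans (count-miss (plus , g) (block g 0 p ++ w) (x≢g ∘ sym ∘ cong proj₂)) (count-block-other x≢g zero p w)
count-block-other x≢g zero zero w = refl

cancel-embed-++ : ∀ u {v v′} → cancel (embed v) ≡ cancel (embed v′) →
                  cancel (embed (u ++ v)) ≡ cancel (embed (u ++ v′))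
cancel-embed-++ []            eq = eq
cancel-embed-++ ((s , g) ∷ u) {v} {v′} eq = cong (push (s , (g , 0))) (cancel-embed-++ u {v} {v′} eq)

cancel-block-pair : ∀ g m p v → cancel (embed (block g (suc m) (suc p) ++ v)) ≡ cancel (embed (block g m p ++ v))
cancel-block-pair g zero    p v = refl
cancel-block-pair g (suc m) p v = cong (push (minus , (g , 0))) (cancel-block-pair g m p v)

-- Deleting a pair at the centre of either block lowers both sides of `p + m′ ≡ p′ + m` by one. This
-- ends with blocks that contain at most one sign each, and the equation makes them identical.
cancel-block : ∀ g m p m′ p′ {v v′} → cancel (embed v) ≡ cancel (embed v′) → p + m′ ≡ p′ + m →
               cancel (embed (block g m p ++ v)) ≡ cancel (embed (block g m′ p′ ++ v′))
cancel-block g (suc m) (suc p) m′ p′ {v} {v′} eq h =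
  trans (cancel-block-pair g m p v)
        (cancel-block g m p m′ p′ {v} {v′} eq (ℕ.suc-injective (trans h (ℕ.+-suc p′ m))))
cancel-block g m p (suc m′) (suc p′) {v} {v′} eq h =
  trans (cancel-block g m p m′ p′ {v} {v′} eq (ℕ.suc-injective (trans (sym (ℕ.+-suc p m′)) h)))
        (sym (cancel-block-pair g m′ p′ v′))
cancel-block g zero zero zero    zero    eq h = eq
cancel-block g zero zero zero    (suc p′) eq ()
cancel-block g zero zero (suc m′) zero   eq ()
cancel-block g zero (suc p) (suc m′) zero eq ()
cancel-block g (suc m) zero zero (suc p′) eq ()
cancel-block g zero (suc p) zero p′ {v} {v′} eq h with refl ← trans (sym (ℕ.+-identityʳ (suc p)))
    (trans h (ℕ.+-identityʳ p′)) =
  cancel-embed-++ (block g 0 (suc p)) {v} {v′} eq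
cancel-block g (suc m) zero m′ zero {v} {v′} eq refl =
  cancel-embed-++ (block g (suc m) 0) {v} {v′} eq

Balanced : List Letter → List Letter → Set
Balanced w w′ = ∀ g → count (plus , g) w + count (minus , g) w′ ≡ count (plus , g) w′ + count (minus , g) w

-- Induction over the labels: in each word all letters of the least label form one initial block,
-- and a block affects the cancelled word only through its excess of pluses over minuses.
cancel-balanced : ∀ {w w′} → AllPairs _⊑_ w → AllPairs _⊑_ w′ → Balanced w w′ →
                  cancel (embed w) ≡ cancel (embed w′)
cancel-balanced {w} {w′} ⊑w ⊑w′ bal =
  -- `go n g` treats words whose labels lie between g and g + n, the upper end excluded; any common
  -- strict bound on the labels can start it.
  go (bound w + bound w′) 0 ⊑w ⊑w′ (All.tabulate (λ _ → z≤n)) (All.tabulate (λ _ → z≤n))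
     (All.map (λ h → <-≤-trans h (ℕ.m≤m+n _ _)) (bounded w))
     (All.map (λ h → <-≤-trans h (ℕ.m≤n+m _ _)) (bounded w′)) bal
  where
  bound : List Letter → ℕ
  bound = foldr (λ x n → suc (proj₂ x) + n) 0
  bounded : ∀ w → All (λ x → proj₂ x < bound w) w
  bounded []      = []
  bounded (x ∷ w) = ℕ.m≤m+n _ _ ∷ All.map (λ h → <-≤-trans h (ℕ.m≤n+m _ _)) (bounded w)

  go : ∀ n g {w w′} → AllPairs _⊑_ w → AllPairs _⊑_ w′ →
       All (λ x → g ≤ proj₂ x) w → All (λ x → g ≤ proj₂ x) w′ →
       All (λ x → proj₂ x < g + n) w → All (λ x → proj₂ x < g + n) w′ →
       Balanced w w′ → cancel (embed w) ≡ cancel (embed w′)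
  go zero g {[]}    {[]}    _ _ _ _ _ _ _ = refl
  go zero g {[]}    {_ ∷ _} _ _ _ (g≤ ∷ _) _ (<g ∷ _) _ = contradiction
      (<-≤-trans (subst (_ <_) (ℕ.+-identityʳ g) <g) g≤) (ℕ.<-irrefl refl)
  go zero g {_ ∷ _}         _ _ (g≤ ∷ _) _ (<g ∷ _) _ _ = contradiction
      (<-≤-trans (subst (_ <_) (ℕ.+-identityʳ g) <g) g≤) (ℕ.<-irrefl refl)
  go (suc n) g sw sw′ lw lw′ uw uw′ bal with splitSorted g sw lw | splitSorted g sw′ lw′
  ... | split m p v refl av sv | split m′ p′ v′ refl av′ sv′ =
    cancel-block g m p m′ p′ {v} {v′} (go n (suc g) sv sv′ av av′ (shift (block g m p) uw)
        (shift (block g m′ p′) uw′) bal-rest) bal-g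
    where
    shift : ∀ u {v} → All (λ x → proj₂ x < g + suc n) (u ++ v) → All (λ x → proj₂ x < suc g + n) v
    shift []      h = All.map (λ {x} → subst (proj₂ x <_) (ℕ.+-suc g n)) h
    shift (_ ∷ u) (_ ∷ h) = shift u h
    absent : ∀ {s v} → All (λ x → g < proj₂ x) v → count (s , g) v ≡ 0
    absent = count-absent ∘ All.map (λ g<x → λ { refl → ℕ.<-irrefl refl g<x })
    cp : ∀ m p {v} → All (λ x → g < proj₂ x) v → count (plus , g) (block g m p ++ v) ≡ p
    cp m p {v} av = trans (count-block-plus g m p v) (trans (cong (p +_) (absent av)) (ℕ.+-identityʳ p))
    cm : ∀ m p {v} → All (λ x → g < proj₂ x) v → count (minus , g) (block g m p ++ v) ≡ m
    cm m p {v} av = trans (count-block-minus g m p v) (trans (cong (m +_) (absent av)) (ℕ.+-identityʳ m))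
    bal-g : p + m′ ≡ p′ + m
    bal-g = trans (cong₂ _+_ (sym (cp m p av)) (sym (cm m′ p′ av′)))
        (trans (bal g) (cong₂ _+_ (cp m′ p′ av′) (cm m p av)))
    bal-rest : Balanced v v′
    bal-rest h with h ≟ g
    ... | yes refl = trans (cong₂ _+_ (absent av) (absent av′)) (sym (cong₂ _+_ (absent av′) (absent av)))
    ... | no h≢g = trans (cong₂ _+_ (sym (count-block-other h≢g m p v)) (sym (count-block-other h≢g m′ p′ v′)))
                   (trans (bal h) (cong₂ _+_ (count-block-other h≢g m′ p′ v′) (count-block-other h≢g m p v)))

-- Row functions of partitions and their corners.

Antitone : (ℕ → ℕ) → Set
Antitone r = ∀ {a c} → a ≤ c → r c ≤ r a

antitone : ∀ {r} → (∀ a → r (suc a) ≤ r a) → Antitone r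
antitone {r} next {a} {c} a≤c = subst (λ c → r c ≤ r a) (ℕ.m∸n+n≡m a≤c) (go (c ∸ a))
  where
  go : ∀ k → r (k + a) ≤ r a
  go zero    = ≤-refl
  go (suc k) = ≤-trans (next (k + a)) (go k)

rows-antitone : ∀ {μ} → IsPartition μ → Antitone (rowLength μ)
rows-antitone {μ} (linked , _) = antitone (next linked)
  where
  next : ∀ {μ} → Linked _≥_ μ → ∀ a → rowLength μ (suc a) ≤ rowLength μ a
  next []               a       = z≤n
  next [-]              a       = z≤n
  next (x≥y ∷ _)        zero    = x≥y
  next (_ ∷ ys)         (suc a) = next ys a

antitone⇒linked : ∀ {μ} → Antitone (rowLength μ) → Linked _≥_ μ
antitone⇒linked {[]}        _    = []
antitone⇒linked {_ ∷ []}    _    = [-]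
antitone⇒linked {_ ∷ _ ∷ _} anti = anti {0} {1} z≤n ∷ antitone⇒linked (anti ∘ s≤s)

rows-injective : ∀ {μ ν} → IsPartition μ → IsPartition ν →
                 (∀ a → rowLength μ a ≡ rowLength ν a) → μ ≡ ν
rows-injective (_ , μ>0) (_ , ν>0) = go μ>0 ν>0
  where
  go : ∀ {μ ν} → All (0 <_) μ → All (0 <_) ν → (∀ a → rowLength μ a ≡ rowLength ν a) → μ ≡ ν
  go []        []        eq = refl
  go []        (y>0 ∷ _) eq = contradiction (eq 0) (ℕ.<⇒≢ y>0)
  go (x>0 ∷ _) []        eq = contradiction (sym (eq 0)) (ℕ.<⇒≢ x>0)
  go (_ ∷ ps)  (_ ∷ qs)  eq = cong₂ _∷_ (eq 0) (go ps qs (eq ∘ suc))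

row⇒<length : ∀ μ {a b} → b < rowLength μ a → a < length μ
row⇒<length (x ∷ μ) {zero}  _ = s≤s z≤n
row⇒<length (x ∷ μ) {suc a} h = s≤s (row⇒<length μ h)

row+column<sum : ∀ {μ} → All (0 <_) μ → ∀ {a b} → b < rowLength μ a → a + b < sum μ
row+column<sum (_∷_ {x = x} _ _)        {zero}  h = <-≤-trans h (ℕ.m≤m+n x _)
row+column<sum (_∷_ {x = x} x>0 xs>0)   {suc a} h = ℕ.+-mono-≤-< x>0 (row+column<sum xs>0 h)

rowLength-applyUpTo : ∀ f n → (∀ a → n ≤ a → f a ≡ 0) → ∀ a → rowLength (applyUpTo f n) a ≡ f a
rowLength-applyUpTo f zero    zeros a       = sym (zeros a z≤n)
rowLength-applyUpTo f (suc n) zeros zero    = refl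
rowLength-applyUpTo f (suc n) zeros (suc a) = rowLength-applyUpTo (f ∘ suc) n (λ a n≤a → zeros (suc a) (s≤s n≤a)) a

rowLength-trimZeros : ∀ μ a → rowLength (trimZeros μ) a ≡ rowLength μ a
rowLength-trimZeros []      a = refl
rowLength-trimZeros (x ∷ μ) a = trans (cons x (trimZeros μ) a) (tail a)
  where
  cons : ∀ x μ a → rowLength (consTrimmed x μ) a ≡ rowLength (x ∷ μ) a
  cons zero    []      zero    = refl
  cons zero    []      (suc a) = refl
  cons zero    (_ ∷ _) a       = refl
  cons (suc x) μ       a       = refl
  tail : ∀ a → rowLength (x ∷ trimZeros μ) a ≡ rowLength (x ∷ μ) a
  tail zero    = refl
  tail (suc a) = rowLength-trimZeros μ a

isPartition-trimZeros : ∀ μ → Antitone (rowLength μ) → IsPartition (trimZeros μ)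
isPartition-trimZeros μ anti = antitone⇒linked trimmed , positive μ anti
  where
  trimmed : Antitone (rowLength (trimZeros μ))
  trimmed {a} {c} a≤c = begin
    rowLength (trimZeros μ) c ≡⟨ rowLength-trimZeros μ c ⟩
    rowLength μ c             ≤⟨ anti a≤c ⟩
    rowLength μ a             ≡⟨ rowLength-trimZeros μ a ⟨
    rowLength (trimZeros μ) a ∎ where open ℕ.≤-Reasoning
  empty : ∀ μ → (∀ a → rowLength μ a ≡ 0) → trimZeros μ ≡ []
  empty []      _     = refl
  empty (x ∷ μ) zeros = cong₂ consTrimmed (zeros 0) (empty μ (zeros ∘ suc))
  positive : ∀ μ → Antitone (rowLength μ) → All (0 <_) (trimZeros μ)
  positive []          anti = []
  positive (zero ∷ μ)  anti rewrite empty μ (λ a → ℕ.n≤0⇒n≡0 (anti {0} {suc a} z≤n)) = []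
  positive (suc x ∷ μ) anti = s≤s z≤n ∷ positive μ (anti ∘ s≤s)

-- Read with the smaller diagram first, this relation describes a removal as well, so that one count
-- of boxes serves both operators.
AddsBox : Position → (ℕ → ℕ) → (ℕ → ℕ) → Set
AddsBox (a , b) r r⁺ = r a ≡ b × r⁺ a ≡ suc b × (∀ c → c ≢ a → r⁺ c ≡ r c)

addToRow-addsBox : ∀ a μ → AddsBox (a , rowLength μ a) (rowLength μ) (rowLength (addToRow a μ))
addToRow-addsBox a μ = refl , same a μ , other a μ
  where
  same : ∀ a μ → rowLength (addToRow a μ) a ≡ suc (rowLength μ a)
  same zero    []      = refl
  same (suc a) []      = same a []
  same zero    (x ∷ μ) = refl
  same (suc a) (x ∷ μ) = same a μ
  other : ∀ a μ c → c ≢ a → rowLength (addToRow a μ) c ≡ rowLength μ c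
  other zero    μ       zero    c≢a = contradiction refl c≢a
  other zero    []      (suc c) c≢a = refl
  other (suc a) []      zero    c≢a = refl
  other (suc a) []      (suc c) c≢a = other a [] c (c≢a ∘ cong suc)
  other zero    (x ∷ μ) (suc c) c≢a = refl
  other (suc a) (x ∷ μ) zero    c≢a = refl
  other (suc a) (x ∷ μ) (suc c) c≢a = other a μ c (c≢a ∘ cong suc)

removeFromRow-addsBox : ∀ a μ {b} → rowLength μ a ≡ suc b →
  AddsBox (a , b) (rowLength (removeFromRow a μ)) (rowLength μ)
removeFromRow-addsBox a μ eq =
    trans (rowLength-trimZeros (decrementRow a μ) a) (trans (same a μ) (cong pred eq)) , eq
  , λ c c≢a → sym (trans (rowLength-trimZeros (decrementRow a μ) c) (other a μ c c≢a))
  where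
  same : ∀ a μ → rowLength (decrementRow a μ) a ≡ pred (rowLength μ a)
  same a       []      = refl
  same zero    (x ∷ μ) = refl
  same (suc a) (x ∷ μ) = same a μ
  other : ∀ a μ c → c ≢ a → rowLength (decrementRow a μ) c ≡ rowLength μ c
  other a       []      c       c≢a = refl
  other zero    (x ∷ μ) zero    c≢a = contradiction refl c≢a
  other zero    (x ∷ μ) (suc c) c≢a = refl
  other (suc a) (x ∷ μ) zero    c≢a = refl
  other (suc a) (x ∷ μ) (suc c) c≢a = other a μ c (c≢a ∘ cong suc)

Outer Inner : (ℕ → ℕ) → Position → Set
Outer r (zero  , b) = r 0 ≡ b
Outer r (suc a , b) = r (suc a) ≡ b × b < r a
Inner r (a , b)     = r a ≡ suc b × r (suc a) ≤ b

outer? : ∀ r p → Dec (Outer r p)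
outer? r (zero  , b) = r 0 ≟ b
outer? r (suc a , b) = (r (suc a) ≟ b) ×-dec (b ℕ.<? r a)

inner? : ∀ r p → Dec (Inner r p)
inner? r (a , b) = (r a ≟ suc b) ×-dec (r (suc a) ℕ.≤? b)

outer-row : ∀ {r} a {b} → Outer r (a , b) → r a ≡ b
outer-row zero    h       = h
outer-row (suc a) (h , _) = h

outer-above : ∀ {r} → Antitone r → ∀ {a b c} → Outer r (a , b) → c < a → b < r c
outer-above anti {suc a} (_ , b<) (s≤s c≤a) = <-≤-trans b< (anti c≤a)

inner-below : ∀ {r} → Antitone r → ∀ {a b c} → Inner r (a , b) → a < c → r c ≤ b
inner-below anti (_ , ≤b) a<c = ≤-trans (anti a<c) ≤b

addsBox-antitone : ∀ {r r⁺ a b} → Antitone r → AddsBox (a , b) r r⁺ → Outer r (a , b) → Antitone r⁺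
addsBox-antitone {r} {r⁺} {a} {b} anti (refl , r⁺a , other) outer {x} {y} x≤y with x ≟ a | y ≟ a
... | yes refl | yes refl = ≤-refl
... | yes refl | no y≢a rewrite r⁺a | other y y≢a = ℕ.m≤n⇒m≤1+n (anti x≤y)
... | no x≢a | yes refl rewrite r⁺a | other x x≢a = outer-above anti outer (ℕ.≤∧≢⇒< x≤y x≢a)
... | no x≢a | no y≢a rewrite other x x≢a | other y y≢a = anti x≤y

addable⇔outer : ∀ {μ} → IsPartition μ → ∀ p → (Addable μ p → Outer (rowLength μ) p) ×
    (Outer (rowLength μ) p → Addable μ p)
addable⇔outer {μ} μ-part@(_ , μ>0) p@(a , b) = to a , from
  where
  anti = rows-antitone μ-part
  to : ∀ a → Addable μ (a , b) → Outer (rowLength μ) (a , b)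
  to zero    (b≡ , _) = sym b≡
  to (suc a) (refl , μ⁺) with refl , same , other ← addToRow-addsBox (suc a) μ =
    refl , (begin-strict
      rowLength μ (suc a)                      <⟨ ℕ.n<1+n _ ⟩
      suc (rowLength μ (suc a))                ≡⟨ same ⟨
      rowLength (addToRow (suc a) μ) (suc a)   ≤⟨ rows-antitone μ⁺ (ℕ.n≤1+n a) ⟩
      rowLength (addToRow (suc a) μ) a         ≡⟨ other a (ℕ.<⇒≢ (ℕ.n<1+n a)) ⟩
      rowLength μ a                            ∎)
    where open ℕ.≤-Reasoning
  -- Further down, `addToRow` would insert zero parts and the result would not be a partition.
  ≤length : ∀ a → Outer (rowLength μ) (a , b) → a ≤ length μ
  ≤length zero    _        = z≤n
  ≤length (suc a) (_ , b<) = row⇒<length μ b<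
  positive : ∀ {μ} a → All (0 <_) μ → a ≤ length μ → All (0 <_) (addToRow a μ)
  positive zero    []       _       = s≤s z≤n ∷ []
  positive zero    (_ ∷ ps) _       = s≤s z≤n ∷ ps
  positive (suc a) (p ∷ ps) (s≤s h) = p ∷ positive a ps h
  from : Outer (rowLength μ) p → Addable μ p
  from outer with refl ← outer-row a outer =
    refl , antitone⇒linked (addsBox-antitone anti (addToRow-addsBox a μ) outer) , positive a μ>0 (≤length a outer)

addsBox-inner-antitone : ∀ {r r⁻ a b} → Antitone r → AddsBox (a , b) r⁻ r → Inner r (a , b) → Antitone r⁻
addsBox-inner-antitone {r} {r⁻} {a} {b} anti (refl , ra , other) inner {x} {y} x≤y with x ≟ a | y ≟ a
... | yes refl | yes refl = ≤-refl
... | yes refl | no y≢a rewrite sym (other y y≢a) = inner-below anti inner (ℕ.≤∧≢⇒< x≤y (y≢a ∘ sym))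
... | no x≢a | yes refl rewrite sym (other x x≢a) = ≤-trans (ℕ.n≤1+n _) (subst (_≤ r x) ra (anti x≤y))
... | no x≢a | no y≢a rewrite sym (other x x≢a) | sym (other y y≢a) = anti x≤y

removable⇔inner : ∀ {μ} → IsPartition μ → ∀ p → (Removable μ p → Inner (rowLength μ) p) ×
    (Inner (rowLength μ) p → Removable μ p)
removable⇔inner {μ} μ-part p@(a , b) = to , from
  where
  anti = rows-antitone μ-part
  to : Removable μ p → Inner (rowLength μ) p
  to (eq , μ⁻) with same , _ , other ← removeFromRow-addsBox a μ (sym eq) =
    sym eq , (begin
      rowLength μ (suc a)                    ≡⟨ other (suc a) (ℕ.<⇒≢ (ℕ.n<1+n a) ∘ sym) ⟩
      rowLength (removeFromRow a μ) (suc a)  ≤⟨ rows-antitone μ⁻ (ℕ.n≤1+n a) ⟩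
      rowLength (removeFromRow a μ) a        ≡⟨ same ⟩
      b                                      ∎)
    where open ℕ.≤-Reasoning
  from : Inner (rowLength μ) p → Removable μ p
  from inner@(eq , _) = sym eq , isPartition-trimZeros (decrementRow a μ) decremented
    where
    trimmed = addsBox-inner-antitone anti (removeFromRow-addsBox a μ eq) inner
    decremented : Antitone (rowLength (decrementRow a μ))
    decremented {x} {y} x≤y = begin
      rowLength (decrementRow a μ) y  ≡⟨ rowLength-trimZeros (decrementRow a μ) y ⟨
      rowLength (removeFromRow a μ) y ≤⟨ trimmed x≤y ⟩
      rowLength (removeFromRow a μ) x ≡⟨ rowLength-trimZeros (decrementRow a μ) x ⟩
      rowLength (decrementRow a μ) x  ∎ where open ℕ.≤-Reasoning

-- Counting with sums of indicators.

private variable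
  A : Set
  P Q : Set

unique-length : ∀ {xs ys : List A} → Unique xs → Unique ys →
                (∀ {x} → x ∈ xs → x ∈ ys) → (∀ {x} → x ∈ ys → x ∈ xs) → length xs ≡ length ys
unique-length xs! ys! to from = ↭-length (∼bag⇒↭ (unique∧set⇒bag xs! ys! (mk⇔ to from)))

⟦_⟧ : Dec P → ℕ
⟦ yes _ ⟧ = 1
⟦ no  _ ⟧ = 0

⟦⟧≤1 : (p : Dec P) → ⟦ p ⟧ ≤ 1
⟦⟧≤1 (yes _) = ≤-refl
⟦⟧≤1 (no _)  = z≤n

⟦⟧-mono : (p : Dec P) (q : Dec Q) → (P → Q) → ⟦ p ⟧ ≤ ⟦ q ⟧
⟦⟧-mono (no _)  q       f = z≤n
⟦⟧-mono (yes x) (yes _) f = ≤-refl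
⟦⟧-mono (yes x) (no ¬y) f = contradiction (f x) ¬y

⟦⟧-cong : (p : Dec P) (q : Dec Q) → (P → Q) → (Q → P) → ⟦ p ⟧ ≡ ⟦ q ⟧
⟦⟧-cong p q f g = ℕ.≤-antisym (⟦⟧-mono p q f) (⟦⟧-mono q p g)

⟦⟧-yes : (p : Dec P) → P → ⟦ p ⟧ ≡ 1
⟦⟧-yes (yes _) _ = refl
⟦⟧-yes (no ¬x) x = contradiction x ¬x

⟦⟧-no : (p : Dec P) → ¬ P → ⟦ p ⟧ ≡ 0
⟦⟧-no (yes x) ¬x = contradiction x ¬x
⟦⟧-no (no _)  _  = refl

∑ : ℕ → (ℕ → ℕ) → ℕ
∑ zero    f = 0
∑ (suc n) f = f 0 + ∑ n (f ∘ suc)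

∑-mono : ∀ n {f g} → (∀ t → t < n → f t ≤ g t) → ∑ n f ≤ ∑ n g
∑-mono zero    _   = z≤n
∑-mono (suc n) f≤g = ℕ.+-mono-≤ (f≤g 0 (s≤s z≤n)) (∑-mono n λ t t<n → f≤g (suc t) (s≤s t<n))

∑-cong : ∀ n {f g} → (∀ t → t < n → f t ≡ g t) → ∑ n f ≡ ∑ n g
∑-cong n f≡g = ℕ.≤-antisym (∑-mono n λ t t<n → ≤-reflexive (f≡g t t<n))
                           (∑-mono n λ t t<n → ≤-reflexive (sym (f≡g t t<n)))

∑-+ : ∀ n f g → ∑ n (λ t → f t + g t) ≡ ∑ n f + ∑ n g
∑-+ zero    f g = refl
∑-+ (suc n) f g rewrite ∑-+ n (f ∘ suc) (g ∘ suc) = interchange (f 0) (g 0) _ _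
  where
  interchange : ∀ a b c d → (a + b) + (c + d) ≡ (a + c) + (b + d)
  interchange = solve-∀

∑-last : ∀ n f → ∑ (suc n) f ≡ ∑ n f + f n
∑-last zero    f = ℕ.+-identityʳ (f 0)
∑-last (suc n) f rewrite ∑-last n (f ∘ suc) = sym (ℕ.+-assoc (f 0) _ _)

∑-zero : ∀ n {f} → (∀ t → t < n → f t ≡ 0) → ∑ n f ≡ 0
∑-zero zero    _   = refl
∑-zero (suc n) f≡0 rewrite f≡0 0 (s≤s z≤n) = ∑-zero n λ t t<n → f≡0 (suc t) (s≤s t<n)

∑-upperBound : ∀ n k {f} → k ≤ n → (∀ t → f t ≤ 1) → (∀ t → k ≤ t → t < n → f t ≡ 0) → ∑ n f ≤ k
∑-upperBound n       zero    _         _   f≡0 = ≤-reflexive (∑-zero n λ t → f≡0 t z≤n)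
∑-upperBound (suc n) (suc k) (s≤s k≤n) f≤1 f≡0 =
  ℕ.+-mono-≤ (f≤1 0) (∑-upperBound n k k≤n (f≤1 ∘ suc) λ t k≤t t<n → f≡0 (suc t) (s≤s k≤t) (s≤s t<n))

∑-below : ∀ n k → k ≤ n → ∑ n (λ t → ⟦ t <? k ⟧) ≡ k
∑-below n       zero    _         = ∑-zero n λ t _ → ⟦⟧-no (t <? 0) λ ()
∑-below (suc n) (suc k) (s≤s k≤n) =
    cong suc (trans (∑-cong n λ t _ → ⟦⟧-cong (suc t <? suc k) (t <? k) s≤s⁻¹ s≤s) (∑-below n k k≤n))

-- A set closed under predecessors is an initial segment and is therefore recovered from its
-- cardinality. Membership along a ladder, and along a row, is thus read off from a count.
∑-downset : ∀ {D : ℕ → Set} (D? : Decidable D) n → (∀ t → suc t < n → D (suc t) → D t) →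
            ∀ t → t < n → (D t → t < ∑ n (λ t → ⟦ D? t ⟧)) × (t < ∑ n (λ t → ⟦ D? t ⟧) → D t)
∑-downset {D} D? (suc n) down = split-0 (D? 0)
  where
  rest = ∑ n λ t → ⟦ D? (suc t) ⟧
  IH : ∀ t → t < n → (D (suc t) → t < rest) × (t < rest → D (suc t))
  IH = ∑-downset (D? ∘ suc) n λ t t<n → down (suc t) (s≤s t<n)
  split-0 : (d : Dec (D 0)) → ∀ t → t < suc n → (D t → t < ⟦ d ⟧ + rest) × (t < ⟦ d ⟧ + rest → D t)
  split-0 (yes d) zero    _         = (λ _ → s≤s z≤n) , (λ _ → d)
  split-0 (yes d) (suc t) (s≤s t<n) = s≤s ∘ proj₁ (IH t t<n) , proj₂ (IH t t<n) ∘ s≤s⁻¹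
  split-0 (no ¬d) t       t<n       =
    (λ dt → contradiction (to-0 t t<n dt) ¬d) , λ h → contradiction (rest-0 (≤-<-trans z≤n h)) ¬d
    where
    to-0 : ∀ t → t < suc n → D t → D 0
    to-0 zero    _   d = d
    to-0 (suc t) t<n d = to-0 t (<⇒≤ t<n) (down t t<n d)
    nonempty : ∀ n {f} → 0 < ∑ n f → 0 < n
    nonempty (suc n) _ = s≤s z≤n
    rest-0 : 0 < rest → D 0
    rest-0 h with 0<n ← nonempty n h = down 0 (s≤s 0<n) (proj₂ (IH 0 0<n) h)

length-filter-applyUpTo : ∀ {D : A → Set} (D? : Decidable D) h n →
  length (filter D? (applyUpTo h n)) ≡ ∑ n (λ t → ⟦ D? (h t) ⟧)
length-filter-applyUpTo D? h zero    = refl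
length-filter-applyUpTo D? h (suc n) with D? (h 0)
... | yes _ = cong suc (length-filter-applyUpTo D? (h ∘ suc) n)
... | no  _ = length-filter-applyUpTo D? (h ∘ suc) n

-- Either g is identically 1, or some f t = 0 and then the terms of f before
-- (after) position t are dominated by those of g at the same (previous) place.

∑-interleave : ∀ n {f g} → (∀ t → f t ≤ 1) → (∀ t → t < n → f t ≤ g t) → (∀ t → t < n → f (suc t) ≤ g t) →
               n ≤ ∑ n g ⊎ ∑ (suc n) f ≤ ∑ n g
∑-interleave zero    f≤1 _ _ = inj₁ z≤n
∑-interleave (suc n) {f} {g} f≤1 f≤g f⁺≤g = go (f 0) refl
  where
  go : ∀ k → f 0 ≡ k → suc n ≤ ∑ (suc n) g ⊎ ∑ (suc (suc n)) f ≤ ∑ (suc n) g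
  go zero f0 = inj₂ (≤-trans (≤-reflexive (cong (_+ ∑ (suc n) (f ∘ suc)) f0)) (∑-mono (suc n) f⁺≤g))
  go (suc k) f0 with 1≤g ← ≤-trans (s≤s z≤n) (≤-trans (≤-reflexive (sym f0)) (f≤g 0 (s≤s z≤n)))
    with ∑-interleave n (f≤1 ∘ suc) (λ t t<n → f≤g (suc t) (s≤s t<n)) (λ t t<n → f⁺≤g (suc t) (s≤s t<n))
  ... | inj₁ full = inj₁ (ℕ.+-mono-≤ 1≤g full)
  ... | inj₂ le   = inj₂ (ℕ.+-mono-≤ (f≤g 0 (s≤s z≤n)) le)

-- Ladder coordinates and ladder sizes.

_≟ᴾ_ : (p q : Position) → Dec (p ≡ q)
_≟ᴾ_ = ≡-dec _≟_ _≟_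

module _ (m : ℕ) .{{_ : NonZero m}} where

  L : Position → ℕ
  L = ladder (suc m)

  0<m : 0 < m
  0<m = >-nonZero⁻¹ m

  L-cancel : ∀ {a b b′} → L (a , b) ≡ L (a , b′) → b ≡ b′
  L-cancel {a} {b} {b′} eq = ℕ.*-cancelˡ-≡ b b′ m (ℕ.+-cancelˡ-≡ a _ _ eq)

  L-reverse : ∀ {a b a′ b′} → L (a , b) ≡ L (a′ , b′) → a < a′ → b′ < b
  L-reverse {a} {b} {a′} {b′} eq a<a′ = ℕ.*-cancelˡ-< m b′ b (ℕ.+-cancelˡ-< a _ _ (begin-strict
    a + m * b′  <⟨ ℕ.+-monoˡ-< (m * b′) a<a′ ⟩
    a′ + m * b′ ≡⟨ eq ⟨
    a + m * b   ∎))
    where open ℕ.≤-Reasoning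

  -- The ladder through (x , J), x < m, consists of the positions (x + t * m , J ∸ t)
  -- with t ≤ J, listed from top to bottom, and t positions lie above the t-th one.

  rung : ℕ → ℕ → ℕ → Position
  rung x J t = x + t * m , J ∸ t

  rungs : ℕ → ℕ → List Position
  rungs x J = applyUpTo (rung x J) (suc J)

  row-coordinates : ∀ a → ∃₂ λ x t → x < m × a ≡ x + t * m
  row-coordinates a = a % m , a / m , m%n<n a m , m≡m%n+[m/n]*n a m

  coordinates-unique : ∀ {x x′ t t′} → x < m → x′ < m → x + t * m ≡ x′ + t′ * m → x ≡ x′ × t ≡ t′
  coordinates-unique {x} {x′} {t} {t′} x<m x′<m eq =
    x≡x′ , ℕ.*-cancelʳ-≡ t t′ m (ℕ.+-cancelˡ-≡ x′ _ _ (trans (cong (_+ t * m) (sym x≡x′)) eq))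
    where
    rem : ∀ {x} t → x < m → (x + t * m) % m ≡ x
    rem {x} t x<m = trans ([m+kn]%n≡m%n x t m) (m<n⇒m%n≡m x<m)
    x≡x′ = trans (sym (rem t x<m)) (trans (cong (_% m) eq) (rem t′ x′<m))

  L-coordinates : ∀ x t b → L (x + t * m , b) ≡ L (x , b + t)
  L-coordinates x t b = lemma m x t b
    where
    lemma : ∀ m x t b → x + t * m + m * b ≡ x + m * (b + t)
    lemma = solve-∀

  L-rung : ∀ x {J t} → t ≤ J → L (rung x J t) ≡ L (x , J)
  L-rung x {J} {t} t≤J = trans (L-coordinates x t (J ∸ t)) (cong (λ j → L (x , j)) (ℕ.m∸n+n≡m t≤J))

  on-rung : ∀ {x J p} → x < m → L p ≡ L (x , J) → ∃ λ t → t ≤ J × p ≡ rung x J t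
  on-rung {x} {J} {a , b} x<m eq with x′ , t , x′<m , refl ← row-coordinates a
    with refl , refl ← coordinates-unique {t = b + t} {t′ = J} x′<m x<m
           (trans (cong (x′ +_) (ℕ.*-comm (b + t) m))
               (trans (sym (L-coordinates x′ t b)) (trans eq (cong (x +_) (ℕ.*-comm m J)))))
    = t , ℕ.m≤n+m t b , cong (x + t * m ,_) (sym (ℕ.m+n∸n≡m b t))

  rungs-unique : ∀ x J → Unique (rungs x J)
  rungs-unique x J = Unique.applyUpTo⁺₁ (rung x J) (suc J) λ {i} {j} i<j _ eq →
    ℕ.<⇒≢ i<j (ℕ.*-cancelʳ-≡ i j m (ℕ.+-cancelˡ-≡ x _ _ (cong proj₁ eq)))

  ∈-rungs⁺ : ∀ {x J p} → x < m → L p ≡ L (x , J) → p ∈ rungs x J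
  ∈-rungs⁺ {x} {J} x<m eq with t , t≤J , refl ← on-rung x<m eq = ∈-applyUpTo⁺ (rung x J) (s≤s t≤J)

  ∈-rungs⁻ : ∀ {x J p} → p ∈ rungs x J → L p ≡ L (x , J)
  ∈-rungs⁻ {x} {J} p∈ with t , s≤s t≤J , refl ← ∈-applyUpTo⁻ (rung x J) p∈ = L-rung x t≤J

  -- N r x J is the number of boxes on the ladder through (x , J), for the diagram
  -- with row function r.

  N : (ℕ → ℕ) → ℕ → ℕ → ℕ
  N r x J = ∑ (suc J) λ t → ⟦ J ∸ t <? r (x + t * m) ⟧

  N≤ : ∀ r x J → N r x J ≤ suc J
  N≤ r x J = ∑-upperBound (suc J) (suc J) ≤-refl (λ t → ⟦⟧≤1 (J ∸ t <? r (x + t * m))) λ t J<t t<J →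
      contradiction (<-≤-trans t<J J<t) (ℕ.<-irrefl refl)

  positionsAbove-rung : ∀ {x} t b → x < m → positionsAbove (suc m) (x + t * m , b) ≡ t
  positionsAbove-rung {x} t b x<m = trans
    (unique-length
      (Unique.filter⁺ on-ladder? (Unique.cartesianProduct⁺ (Unique.upTo⁺ (proj₁ p)) (Unique.upTo⁺ (suc (L p)))))
      (Unique.applyUpTo⁺₁ (rung x (b + t)) t λ {i} {j} i<j _ eq →
          ℕ.<⇒≢ i<j (ℕ.*-cancelʳ-≡ i j m (ℕ.+-cancelˡ-≡ x _ _ (cong proj₁ eq))))
      to from)
    (length-applyUpTo (rung x (b + t)) t)
    where
    p = x + t * m , b
    on-ladder? = λ q → L q ≟ L p
    rectangle = cartesianProduct (upTo (proj₁ p)) (upTo (suc (L p)))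
    to : ∀ {q} → q ∈ filter on-ladder? rectangle → q ∈ applyUpTo (rung x (b + t)) t
    to q∈ with q∈rect , Lq ← ∈-filter⁻ on-ladder? {xs = rectangle} q∈
      with s , _ , refl ← on-rung x<m (trans Lq (L-coordinates x t b)) =
      ∈-applyUpTo⁺ (rung x (b + t)) (ℕ.*-cancelʳ-< m s t (ℕ.+-cancelˡ-< x _ _
        (∈-upTo⁻ (proj₁ (∈-cartesianProduct⁻ (upTo (proj₁ p)) (upTo (suc (L p))) q∈rect)))))
    from : ∀ {q} → q ∈ applyUpTo (rung x (b + t)) t → q ∈ filter on-ladder? rectangle
    from q∈ with s , s<t , refl ← ∈-applyUpTo⁻ (rung x (b + t)) q∈ =
      ∈-filter⁺ on-ladder? (∈-cartesianProduct⁺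
          (∈-upTo⁺ (ℕ.+-monoʳ-< x (ℕ.*-monoˡ-< m s<t)))
          (∈-upTo⁺ (s≤s (≤-trans (column≤ (rung x (b + t) s)) (≤-reflexive Lq)))))
        Lq
      where
      Lq = trans (L-rung x (≤-trans (<⇒≤ s<t) (ℕ.m≤n+m t b))) (sym (L-coordinates x t b))
      column≤ : ∀ q → proj₂ q ≤ L q
      column≤ (c , d) = ≤-trans (ℕ.m≤n*m d m) (ℕ.m≤n+m (m * d) c)

  ladderSize-N : ∀ {μ x} J → All (0 <_) μ → x < m → ladderSize (suc m) μ (L (x , J)) ≡ N (rowLength μ) x J
  ladderSize-N {μ} {x} J μ>0 x<m = trans
    (unique-length
      (Unique.filter⁺ on-ladder? (Unique.filter⁺ (_∈Diagram? μ)
          (Unique.cartesianProduct⁺ (Unique.upTo⁺ (length μ)) (Unique.upTo⁺ (sum μ)))))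
      (Unique.filter⁺ (_∈Diagram? μ) (rungs-unique x J)) to from)
    (length-filter-applyUpTo (_∈Diagram? μ) (rung x J) (suc J))
    where
    on-ladder? = λ q → L q ≟ L (x , J)
    rectangle = cartesianProduct (upTo (length μ)) (upTo (sum μ))
    to : ∀ {q} → q ∈ filter on-ladder? (boxes μ) → q ∈ filter (_∈Diagram? μ) (rungs x J)
    to q∈ with q∈boxes , Lq ← ∈-filter⁻ on-ladder? {xs = boxes μ} q∈
      with _ , q∈μ ← ∈-filter⁻ (_∈Diagram? μ) {xs = rectangle} q∈boxes =
      ∈-filter⁺ (_∈Diagram? μ) (∈-rungs⁺ x<m Lq) q∈μ
    from : ∀ {q} → q ∈ filter (_∈Diagram? μ) (rungs x J) → q ∈ filter on-ladder? (boxes μ)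
    from {a , b} q∈ with q∈rungs , q∈μ ← ∈-filter⁻ (_∈Diagram? μ) {xs = rungs x J} q∈ =
      ∈-filter⁺ on-ladder? (∈-filter⁺ (_∈Diagram? μ) (∈-cartesianProduct⁺
        (∈-upTo⁺ (row⇒<length μ q∈μ))
        (∈-upTo⁺ (≤-<-trans (ℕ.m≤n+m b a) (row+column<sum μ>0 q∈μ)))) q∈μ) (∈-rungs⁻ q∈rungs)

  ∑-hits : ℕ → ℕ → Position → ℕ
  ∑-hits x J p = ∑ (suc J) λ t → ⟦ rung x J t ≟ᴾ p ⟧

  -- A ladder contains a given position once or not at all. Hence adding either of two positions on
  -- a common ladder has the same effect on all ladder sizes.
  ∑-hits-ladder : ∀ {x J p q} → x < m → L p ≡ L q → ∑-hits x J p ≡ ∑-hits x J q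
  ∑-hits-ladder {x} {J} {p} {q} x<m eq with L p ≟ L (x , J)
  ... | yes Lp = trans (hit Lp) (sym (hit (trans (sym eq) Lp)))
    where
    hit : ∀ {p} → L p ≡ L (x , J) → ∑-hits x J p ≡ 1
    hit {p} Lp = trans (sym (length-filter-applyUpTo (_≟ᴾ p) (rung x J) (suc J)))
      (unique-length (Unique.filter⁺ (_≟ᴾ p) (rungs-unique x J)) ([] ∷ [])
        (λ q∈ → here (proj₂ (∈-filter⁻ (_≟ᴾ p) {xs = rungs x J} q∈)))
        λ { (here refl) → ∈-filter⁺ (_≟ᴾ p) (∈-rungs⁺ x<m Lp) refl })
  ... | no ¬Lp = trans (miss ¬Lp) (sym (miss (¬Lp ∘ trans eq)))
    where
    miss : ∀ {p} → L p ≢ L (x , J) → ∑-hits x J p ≡ 0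
    miss {p} ¬Lp = ∑-zero (suc J) λ t t≤J → ⟦⟧-no (rung x J t ≟ᴾ p) λ { refl → ¬Lp (L-rung x (s≤s⁻¹ t≤J)) }

  N-addsBox : ∀ {p r r⁺} → AddsBox p r r⁺ → ∀ x J → N r⁺ x J ≡ N r x J + ∑-hits x J p
  N-addsBox {p@(a , b)} {r} {r⁺} (ra , r⁺a , other) x J =
    trans (∑-cong (suc J) λ t _ → pointwise (rung x J t))
          (∑-+ (suc J) (λ t → ⟦ J ∸ t <? r (x + t * m) ⟧) (λ t → ⟦ rung x J t ≟ᴾ p ⟧))
    where
    pointwise : ∀ q → ⟦ proj₂ q <? r⁺ (proj₁ q) ⟧ ≡ ⟦ proj₂ q <? r (proj₁ q) ⟧ + ⟦ q ≟ᴾ p ⟧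
    pointwise (c , d) with c ≟ a
    ... | no c≢a rewrite other c c≢a = sym (ℕ.+-identityʳ _)
    ... | yes refl rewrite ra | r⁺a with d ≟ b
    ...   | yes refl rewrite ⟦⟧-yes (b <? suc b) ≤-refl | ⟦⟧-no (b <? b) (ℕ.<-irrefl refl) = refl
    ...   | no d≢b =
      trans (⟦⟧-cong (d <? suc b) (d <? b) (λ d<1+b → ℕ.≤∧≢⇒< (s≤s⁻¹ d<1+b) d≢b) ℕ.m≤n⇒m≤1+n)
          (sym (ℕ.+-identityʳ _))

  -- ℓ-regularity of a diagram with row function r: rows a and m + a = a + (ℓ ∸ 1)
  -- have different lengths unless both are empty.  Equivalently, the boxes on each
  -- ladder are the topmost positions of that ladder.

  Regular : (ℕ → ℕ) → Set
  Regular r = ∀ a b → b < r (m + a) → suc b < r a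

  -- The position with index s + 1 on a ladder lies m rows below and one column to the left of the
  -- one with index s, so regularity makes membership along the ladder a downset.
  ∈-regular : ∀ {r} → Regular r → ∀ x t b → (b < r (x + t * m) → t < N r x (b + t)) ×
      (t < N r x (b + t) → b < r (x + t * m))
  ∈-regular {r} regular x t b =
      proj₁ downset ∘ subst (_< r (x + t * m)) (sym (ℕ.m+n∸n≡m b t))
    , subst (_< r (x + t * m)) (ℕ.m+n∸n≡m b t) ∘ proj₂ downset
    where
    D : ℕ → Set
    D s = b + t ∸ s < r (x + s * m)
    D? : Decidable D
    D? s = b + t ∸ s <? r (x + s * m)
    swap : ∀ x m y → x + (m + y) ≡ m + (x + y)
    swap = solve-∀
    down : ∀ s → suc s < suc (b + t) → D (suc s) → D s
    down s (s≤s s<J) h = subst (_< r (x + s * m)) (sym (ℕ.+-∸-assoc 1 s<J))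
      (regular _ _ (subst (λ a → b + t ∸ suc s < r a) (swap x m (s * m)) h))
    downset = ∑-downset D? (suc (b + t)) down t (s≤s (ℕ.m≤n+m t b))

  <-determines : ∀ {k n} → (∀ b → b < k → b < n) → k ≤ n
  <-determines {zero}  _ = z≤n
  <-determines {suc k} h = h k ≤-refl

  regular-unique : ∀ {r r′} → Regular r → Regular r′ → (∀ {x} J → x < m → N r x J ≡ N r′ x J) → ∀ a → r a ≡ r′ a
  regular-unique {r} {r′} reg reg′ eq a = ℕ.≤-antisym (<-determines (half reg reg′ eq))
      (<-determines (half reg′ reg λ J x<m → sym (eq J x<m)))
    where
    half : ∀ {r r′} → Regular r → Regular r′ → (∀ {x} J → x < m → N r x J ≡ N r′ x J) → ∀ b → b < r a → b < r′ a
    half reg reg′ eq b h with x , t , x<m , refl ← row-coordinates a =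
      proj₂ (∈-regular reg′ x t b) (subst (t <_) (eq (b + t) x<m) (proj₁ (∈-regular reg x t b) h))

  module _ {r} (anti : Antitone r) where

    -- A box on the ladder through (x , J + 1) forces its left neighbour and the position m rows
    -- above it, where these exist, into the diagram. They are consecutive positions of the ladder
    -- through (x , J), so that ladder is full or has at least as many boxes. This is why the rows
    -- of the regularized diagram have no gaps.
    N-left : ∀ x {t J} → t ≤ J → t < N r x (suc J) → t < N r x J
    N-left x {t} {J} t≤J h with ∑-interleave (suc J)
      (λ s → ⟦⟧≤1 (suc J ∸ s <? r (x + s * m)))
      (λ s _ → ⟦⟧-mono (suc J ∸ s <? r (x + s * m)) (J ∸ s <? r (x + s * m))
          (≤-<-trans (ℕ.∸-monoˡ-≤ s (ℕ.n≤1+n J))))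
      (λ s _ → ⟦⟧-mono (J ∸ s <? r (x + suc s * m)) (J ∸ s <? r (x + s * m))
                 λ lt → <-≤-trans lt (anti (ℕ.+-monoʳ-≤ x (ℕ.m≤n+m (s * m) m))))
    ... | inj₁ full = ≤-trans (s≤s t≤J) full
    ... | inj₂ le   = <-≤-trans h le

    N-up : ∀ x J → N r (suc x) J ≤ N r x J
    N-up x J = ∑-mono (suc J) λ t _ → ⟦⟧-mono (J ∸ t <? r (suc x + t * m)) (J ∸ t <? r (x + t * m)) λ lt →
        <-≤-trans lt (anti (ℕ.n≤1+n _))

    -- One step up from row (t + 1) m is row (m - 1) + t m, so indices on the ladder drop by one.
    -- The top position (0 , J + 1) has nothing above it and accounts for the extra 1.
    N-up-across : ∀ x J → suc x ≡ m → N r 0 (suc J) ≤ suc (N r x J)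
    N-up-across x J refl = ℕ.+-mono-≤ (⟦⟧≤1 (suc J <? r 0)) (∑-mono (suc J) λ t _ →
      ⟦⟧-mono (J ∸ t <? r (suc t * m)) (J ∸ t <? r (x + t * m)) λ lt → <-≤-trans lt (anti (ℕ.n≤1+n _)))

  -- The regularization of a partition is a regular partition with the same ladder sizes.

  module Regularization {μ} (μ-part : IsPartition μ) where

    private
      r = rowLength μ
      anti : Antitone r
      anti = rows-antitone μ-part
      ρ = regularizedRow (suc m) μ
      row = rowLength (ℛ (suc m) μ)

      -- Membership of (x + t m , b) in the regularized diagram: that position has index t on the
      -- ladder through (x , b + t).
      InN : ℕ → ℕ → ℕ → Set
      InN x t b = t < N r x (b + t)

      inN⇔ : ∀ {x} t b → x < m → (positionsAbove (suc m) (x + t * m , b) < ladderSize (suc m) μ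
          (L (x + t * m , b))) ≡ InN x t b
      inN⇔ {x} t b x<m = cong₂ _<_ (positionsAbove-rung t b x<m)
        (trans (cong (ladderSize (suc m) μ) (L-coordinates x t b)) (ladderSize-N (b + t) (proj₂ μ-part) x<m))

      -- If row x + t m and all rows below it are empty, only the first t positions of the ladder
      -- can be boxes.
      inN⇒row : ∀ x t b → InN x t b → x + t * m < length μ
      inN⇒row x t b h = ℕ.≰⇒> λ len≤ → contradiction h
          (ℕ.≤⇒≯ (∑-upperBound (suc (b + t)) t (≤-trans (ℕ.m≤n+m t b) (ℕ.n≤1+n _))
        (λ s → ⟦⟧≤1 (b + t ∸ s <? r (x + s * m)))
        λ s t≤s _ → ⟦⟧-no (b + t ∸ s <? r (x + s * m)) λ lt →
          contradiction (row⇒<length μ lt) (ℕ.≤⇒≯ (≤-trans len≤ (ℕ.+-monoʳ-≤ x (ℕ.*-monoˡ-≤ m t≤s))))))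

      -- The position with index s has row plus column at least s + (b + t - s) ≥ b, whereas a box
      -- has row plus column below `sum μ`. Hence the finite range of columns inspected by
      -- `regularizedRow` misses nothing.
      inN⇒column : ∀ x t b → InN x t b → b < sum μ
      inN⇒column x t b h = ℕ.≰⇒> λ sum≤b → contradiction h
          (ℕ.≤⇒≯ (≤-trans (≤-reflexive (∑-zero (suc (b + t)) λ s s≤ →
        ⟦⟧-no (b + t ∸ s <? r (x + s * m)) λ lt → contradiction (row+column<sum (proj₂ μ-part) lt) (ℕ.≤⇒≯ (begin
          sum μ                       ≤⟨ sum≤b ⟩
          b                           ≤⟨ ℕ.m≤m+n b t ⟩
          b + t                       ≡⟨ ℕ.m+[n∸m]≡n (s≤s⁻¹ s≤) ⟨
          s + (b + t ∸ s)             ≤⟨ ℕ.+-monoˡ-≤ (b + t ∸ s) (≤-trans (ℕ.m≤m*n s m) (ℕ.m≤n+m (s * m) x)) ⟩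
          x + s * m + (b + t ∸ s)     ∎)))) z≤n))
        where open ℕ.≤-Reasoning

      inN-left : ∀ x t b → InN x t (suc b) → InN x t b
      inN-left x t b = N-left anti x (ℕ.m≤n+m t b)

      ρ-∑ : ∀ a → ρ a ≡ ∑ (sum μ) (λ b → ⟦ _∈Regularized?_ (suc m) (a , b) μ ⟧)
      ρ-∑ a = length-filter-applyUpTo (λ b → _∈Regularized?_ (suc m) (a , b) μ) (λ b → b) (sum μ)

      ∈ρ : ∀ {x} t b → x < m → (b < ρ (x + t * m) → InN x t b) × (InN x t b → b < ρ (x + t * m))
      ∈ρ {x} t b x<m = to , from
        where
        a = x + t * m
        coe : ∀ b → _∈Regularized_ (suc m) (a , b) μ → InN x t b
        coe b = subst (λ A → A) (inN⇔ t b x<m)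
        coe⁻¹ : ∀ b → InN x t b → _∈Regularized_ (suc m) (a , b) μ
        coe⁻¹ b = subst (λ A → A) (sym (inN⇔ t b x<m))
        downset : b < sum μ → _
        downset = ∑-downset (λ b → _∈Regularized?_ (suc m) (a , b) μ) (sum μ)
                    (λ b _ → coe⁻¹ b ∘ inN-left x t b ∘ coe (suc b)) b
        ρ≤sum : ρ a ≤ sum μ
        ρ≤sum = ≤-trans (≤-reflexive (ρ-∑ a)) (∑-upperBound (sum μ) (sum μ) ≤-refl
          (λ b → ⟦⟧≤1 (_∈Regularized?_ (suc m) (a , b) μ)) λ b ≤b b< → contradiction b< (ℕ.≤⇒≯ ≤b))
        to : b < ρ a → InN x t b
        to h = coe b (proj₂ (downset (<-≤-trans h ρ≤sum)) (subst (b <_) (ρ-∑ a) h))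
        from : InN x t b → b < ρ a
        from h = subst (b <_) (sym (ρ-∑ a)) (proj₁ (downset (inN⇒column x t b h)) (coe⁻¹ b h))

      ρ-antitone : Antitone ρ
      ρ-antitone = antitone λ a → <-determines (up a)
        where
        up : ∀ a b → b < ρ (suc a) → b < ρ a
        up a b h with x , t , x<m , refl ← row-coordinates a with suc x <? m
        ... | yes x+1<m = proj₂ (∈ρ t b x<m) (<-≤-trans (proj₁ (∈ρ t b x+1<m) h) (N-up anti x (b + t)))
        -- The next row is (t + 1) m, with remainder 0. Its index is one larger, which pays for the
        -- 1 in `N-up-across`.
        ... | no ¬x+1<m with x+1≡m ← ℕ.≤-antisym x<m (ℕ.≮⇒≥ ¬x+1<m) =
          proj₂ (∈ρ t b x<m) (s≤s⁻¹ (<-≤-trans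
            (subst (λ J → suc t < N r 0 J) (ℕ.+-suc b t)
              (proj₁ (∈ρ (suc t) b 0<m) (subst (λ k → b < ρ (k + t * m)) x+1≡m h)))
            (N-up-across anti x (b + t) x+1≡m)))

      ρ-beyond : ∀ a → length μ ≤ a → ρ a ≡ 0
      ρ-beyond a len≤a with x , t , x<m , refl ← row-coordinates a =
        ℕ.n≤0⇒n≡0 (<-determines λ b h → contradiction (inN⇒row x t b (proj₁ (∈ρ t b x<m) h)) (ℕ.≤⇒≯ len≤a))

      untrimmed : ∀ a → rowLength (List.map ρ (upTo (length μ))) a ≡ ρ a
      untrimmed a = trans (cong (λ ν → rowLength ν a) (map-upTo ρ (length μ)))
          (rowLength-applyUpTo ρ (length μ) ρ-beyond a)

      row≡ρ : ∀ a → row a ≡ ρ a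
      row≡ρ a = trans (rowLength-trimZeros (List.map ρ (upTo (length μ))) a) (untrimmed a)

      ∈row : ∀ {x} t b → x < m → (b < row (x + t * m) → InN x t b) × (InN x t b → b < row (x + t * m))
      ∈row {x} t b x<m rewrite row≡ρ (x + t * m) = ∈ρ t b x<m

    ℛ-isPartition : IsPartition (ℛ (suc m) μ)
    ℛ-isPartition = isPartition-trimZeros (List.map ρ (upTo (length μ))) λ {a} {c} a≤c →
      ≤-trans (≤-reflexive (untrimmed c)) (≤-trans (ρ-antitone a≤c) (≤-reflexive (sym (untrimmed a))))

    -- The positions (m + a , b) and (a , b + 1) are consecutive on one ladder, and the latter is
    -- the upper one, so it is filled earlier.
    ℛ-regular : Regular (rowLength (ℛ (suc m) μ))
    ℛ-regular a b h with x , t , x<m , refl ← row-coordinates a =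
      proj₂ (∈row t (suc b) x<m) (<⇒≤ (subst (λ J → suc t < N r x J) (ℕ.+-suc b t)
        (proj₁ (∈row (suc t) b x<m) (subst (λ a → b < row a) (swap m x (t * m)) h))))
      where
      swap : ∀ m x y → m + (x + y) ≡ x + (m + y)
      swap = solve-∀

    ℛ-N : ∀ {x} J → x < m → N (rowLength (ℛ (suc m) μ)) x J ≡ N r x J
    ℛ-N {x} J x<m = trans
      (∑-cong (suc J) λ t t≤J → ⟦⟧-cong (J ∸ t <? row (x + t * m)) (t <? N r x J)
        (subst (λ j → t < N r x j) (ℕ.m∸n+n≡m (s≤s⁻¹ t≤J)) ∘ proj₁ (∈row t (J ∸ t) x<m))
        (proj₂ (∈row t (J ∸ t) x<m) ∘ subst (λ j → t < N r x j) (sym (ℕ.m∸n+n≡m (s≤s⁻¹ t≤J)))))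
      (∑-below (suc J) (N r x J) (N≤ r x J))

  -- Residues and ladder numbers.

  -- Since L (a , b) + (b - a) = ℓ b, the residue is the negative of the ladder number modulo ℓ.
  -- Comparing residues thereby becomes divisibility of natural numbers.
  ℓ∣L+residue : ∀ p → suc m ∣ L p + residue (suc m) p
  ℓ∣L+residue (a , b) = ∣⇒∣ᵤ {pos (suc m)} {pos (L (a , b) + ρ)} (dividesℤ (pos b ℤ.- q) eq)
    where
    d = pos b ℤ.- pos a
    ρ = d %ℕ suc m
    q = d /ℕ suc m
    rearrange : ∀ a b m ρ q → b ℤ.- a ≡ ρ ℤ.+ q ℤ.* (ℤ.1ℤ ℤ.+ m) →
                a ℤ.+ m ℤ.* b ℤ.+ ρ ≡ (b ℤ.- q) ℤ.* (ℤ.1ℤ ℤ.+ m)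
    rearrange a b m ρ q h = trans (lhs a b m ρ q)
        (trans (cong (λ z → a ℤ.+ m ℤ.* b ℤ.+ z ℤ.- q ℤ.* (ℤ.1ℤ ℤ.+ m)) (sym h)) (rhs a b m q))
      where
      lhs : ∀ a b m ρ q → a ℤ.+ m ℤ.* b ℤ.+ ρ ≡ a ℤ.+ m ℤ.* b ℤ.+ (ρ ℤ.+ q ℤ.* (ℤ.1ℤ ℤ.+ m)) ℤ.- q ℤ.* (ℤ.1ℤ ℤ.+ m)
      lhs = ℤ-Solver.solve-∀
      rhs : ∀ a b m q → a ℤ.+ m ℤ.* b ℤ.+ (b ℤ.- a) ℤ.- q ℤ.* (ℤ.1ℤ ℤ.+ m) ≡ (b ℤ.- q) ℤ.* (ℤ.1ℤ ℤ.+ m)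
      rhs = ℤ-Solver.solve-∀
    eq : pos (L (a , b) + ρ) ≡ (pos b ℤ.- q) ℤ.* pos (suc m)
    eq = trans (trans (ℤ.pos-+ (a + m * b) ρ)
        (cong (ℤ._+ pos ρ) (trans (ℤ.pos-+ a (m * b)) (cong (λ z → pos a ℤ.+ z) (ℤ.pos-* m b)))))
               (rearrange (pos a) (pos b) (pos m) (pos ρ) q (a≡a%ℕn+[a/ℕn]*n d (suc m)))

  residue< : ∀ p → residue (suc m) p < suc m
  residue< (a , b) = n%ℕd<d (pos b ℤ.- pos a) (suc m)

  ∣+⇒≡ : ∀ {n x y k} → x ≤ y → y < n → n ∣ k + x → n ∣ k + y → x ≡ y
  ∣+⇒≡ {n} {x} {y} {k} x≤y y<n n∣x n∣y = go (y ∸ x) (ℕ.m+[n∸m]≡n x≤y)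
    where
    go : ∀ d → x + d ≡ y → x ≡ y
    go zero    eq   = trans (sym (ℕ.+-identityʳ x)) eq
    go (suc d) refl = contradiction (∣⇒≤ n∣d) (ℕ.<⇒≱ (≤-<-trans (ℕ.m≤n+m (suc d) x) y<n))
      where
      n∣d : n ∣ suc d
      n∣d = ∣m+n∣m⇒∣n (subst (n ∣_) (sym (ℕ.+-assoc k x (suc d))) n∣y) n∣x

  residue-unique : ∀ {p ρ} → ρ < suc m → suc m ∣ L p + ρ → residue (suc m) p ≡ ρ
  residue-unique {p} {ρ} ρ<ℓ ℓ∣ with ℕ.≤-total ρ (residue (suc m) p)
  ... | inj₁ le = sym (∣+⇒≡ {k = L p} le (residue< p) ℓ∣ (ℓ∣L+residue p))
  ... | inj₂ ge = ∣+⇒≡ {k = L p} ge ρ<ℓ (ℓ∣L+residue p) ℓ∣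

  residue-ladder : ∀ {p q} → L p ≡ L q → residue (suc m) p ≡ residue (suc m) q
  residue-ladder {p} {q} eq = residue-unique {p} (residue< q) (subst (λ k → suc m ∣ k + residue (suc m) q)
      (sym eq) (ℓ∣L+residue q))

  L-diagonal : ∀ a b → L (suc a , suc b) ≡ suc m + L (a , b)
  L-diagonal a b = lemma m a b
    where
    lemma : ∀ m a b → suc a + m * suc b ≡ suc m + (a + m * b)
    lemma = solve-∀

  residue-diagonal : ∀ a b → residue (suc m) (suc a , suc b) ≡ residue (suc m) (a , b)
  residue-diagonal a b = residue-unique {suc a , suc b} (residue< (a , b)) (subst (suc m ∣_)
    (trans (sym (ℕ.+-assoc (suc m) (L (a , b)) _)) (cong (_+ residue (suc m) (a , b)) (sym (L-diagonal a b))))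
    (∣m∣n⇒∣m+n n∣n (ℓ∣L+residue (a , b))))

  residue-gap : ∀ {p q} → residue (suc m) p ≡ residue (suc m) q → L p < L q → suc m + L p ≤ L q
  residue-gap {p} {q} eq Lp<Lq = go (L q ∸ L p) (ℕ.m+[n∸m]≡n (<⇒≤ Lp<Lq))
    where
    go : ∀ d → L p + d ≡ L q → suc m + L p ≤ L q
    go zero    h = contradiction (trans (sym (ℕ.+-identityʳ (L p))) h) (ℕ.<⇒≢ Lp<Lq)
    go (suc d) h = ≤-trans (≤-reflexive (ℕ.+-comm (suc m) (L p)))
        (≤-trans (ℕ.+-monoʳ-≤ (L p) (∣⇒≤ ℓ∣d)) (≤-reflexive h))
      where
      swap : ∀ a b c → a + b + c ≡ a + c + b
      swap = solve-∀
      ℓ∣d : suc m ∣ suc d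
      ℓ∣d = ∣m+n∣m⇒∣n (subst (suc m ∣_) (trans (cong₂ _+_ (sym h) (sym eq)) (swap (L p) (suc d) _))
          (ℓ∣L+residue q)) (ℓ∣L+residue p)

  residue-adjacent : ∀ a b → residue (suc m) (a , b) ≢ residue (suc m) (a , suc b)
  residue-adjacent a b eq = contradiction
    (residue-gap {a , b} {a , suc b} eq (ℕ.+-monoʳ-< a (ℕ.*-monoʳ-< m (ℕ.n<1+n b))))
    (ℕ.<⇒≱ (s≤s (≤-reflexive (lemma m a b))))
    where
    lemma : ∀ m a b → a + m * suc b ≡ m + (a + m * b)
    lemma = solve-∀

  -- Labels and signatures.

  -- A minus is labelled by the next ladder of its residue, so that the pairs - +
  -- straddling two consecutive ladders of a signature carry a common label.

  label : Sign × Position → ℕ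
  label (plus  , p)       = L p
  label (minus , (a , b)) = L (suc a , suc b)

  toLetter : Sign × Position → Letter
  toLetter x = proj₁ x , label x

  _⊑ᴸ_ : Sign × Position → Sign × Position → Set
  x ⊑ᴸ y = toLetter x ⊑ toLetter y

  Marked : (ℕ → ℕ) → Sign → Position → Set
  Marked r plus  = Outer r
  Marked r minus = Inner r

  -- Distinct ladders of one residue are at least ℓ apart, so a minus, although its label is shifted
  -- by ℓ, does not overtake a plus on a later ladder; at distance exactly ℓ the labels agree and
  -- `minus≤` applies. Within a ladder only a minus before a plus breaks the order.
  ⊑ᴸ-intro : ∀ {s p t q} → residue (suc m) p ≡ residue (suc m) q →
             L p < L q ⊎ (L p ≡ L q × ¬ (s ≡ minus × t ≡ plus)) → (s , p) ⊑ᴸ (t , q)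
  ⊑ᴸ-intro {s} {p} {t} {q@(c , d)} res (inj₁ lt) with residue-gap {p} {q} res lt
  ⊑ᴸ-intro {plus}  {p}     {plus}          res (inj₁ lt) | gap = label< lt
  ⊑ᴸ-intro {plus}  {p}     {minus} {c , d} res (inj₁ lt) | gap =
    label< (<-≤-trans lt (≤-trans (ℕ.m≤n+m _ (suc m)) (≤-reflexive (sym (L-diagonal c d)))))
  ⊑ᴸ-intro {minus} {a , b} {minus} {c , d} res (inj₁ lt) | gap =
    label< (subst₂-< (L-diagonal a b) (L-diagonal c d) (ℕ.+-monoʳ-< (suc m) lt))
    where
    subst₂-< : ∀ {x x′ y y′} → x ≡ x′ → y ≡ y′ → x′ < y′ → x < y
    subst₂-< refl refl h = h
  ⊑ᴸ-intro {minus} {a , b} {plus}  {q}     res (inj₁ lt) | gap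
    with ℕ.m≤n⇒m<n∨m≡n (≤-trans (≤-reflexive (L-diagonal a b)) gap)
  ... | inj₁ lt′ = label< lt′
  ... | inj₂ eq  = subst (λ g → (minus , g) ⊑ (plus , L q)) (sym eq) minus≤
  ⊑ᴸ-intro {plus}  {p}     {plus}  {q}     res (inj₂ (eq , _)) = subst (λ g → (plus , g) ⊑ (plus , L q))
      (sym eq) plus≤
  ⊑ᴸ-intro {plus}  {p}     {minus} {c , d} res (inj₂ (eq , _)) =
    label< (subst (_< L (suc c , suc d)) (sym eq) (subst (L (c , d) <_) (sym (L-diagonal c d)) (s≤s (ℕ.m≤n+m _ m))))
  ⊑ᴸ-intro {minus} {a , b} {minus} {c , d} res (inj₂ (eq , _)) =
    subst (λ g → (minus , g) ⊑ (minus , L (suc c , suc d)))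
        (trans (L-diagonal c d) (trans (cong (_+_ (suc m)) (sym eq)) (sym (L-diagonal a b)))) minus≤
  ⊑ᴸ-intro {minus} {p}     {plus}          res (inj₂ (_ , ok)) = contradiction (refl , refl) ok

  record IsSignature (i : ℕ) (r : ℕ → ℕ) (w : Word) : Set where
    field
      sound    : ∀ {s p} → (s , p) ∈ w → residue (suc m) p ≡ i × Marked r s p
      complete : ∀ {s p} → residue (suc m) p ≡ i → Marked r s p → (s , p) ∈ w
      unique   : Unique w
      sorted   : AllPairs _⊑ᴸ_ w

  -- Counting corners and row ends along a ladder.

  Inner⁺ : (ℕ → ℕ) → Position → Set
  Inner⁺ r (suc a , suc b) = Inner r (a , b)
  Inner⁺ r _               = ⊥

  inner⁺? : ∀ r p → Dec (Inner⁺ r p)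
  inner⁺? r (zero  , _)     = no λ ()
  inner⁺? r (suc _ , zero)  = no λ ()
  inner⁺? r (suc a , suc b) = inner? r (a , b)

  rowEnd? : ∀ (r : ℕ → ℕ) (p : Position) → Dec (r (proj₁ p) ≡ proj₂ p)
  rowEnd? r (a , b) = r a ≟ b

  RowEnd⁺ : (ℕ → ℕ) → Position → Set
  RowEnd⁺ r (zero  , b) = ⊥
  RowEnd⁺ r (suc a , b) = r a ≡ b

  rowEnd⁺? : ∀ r p → Dec (RowEnd⁺ r p)
  rowEnd⁺? r (zero  , b) = no λ ()
  rowEnd⁺? r (suc a , b) = r a ≟ b

  #outer #inner⁺ #rowEnd #rowEnd⁺ : (ℕ → ℕ) → ℕ → ℕ → ℕ
  #outer   r x J = ∑ (suc J) λ t → ⟦ outer? r (rung x J t) ⟧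
  #inner⁺  r x J = ∑ (suc J) λ t → ⟦ inner⁺? r (rung x J t) ⟧
  #rowEnd  r x J = ∑ (suc J) λ t → ⟦ rowEnd? r (rung x J t) ⟧
  #rowEnd⁺ r x J = ∑ (suc J) λ t → ⟦ rowEnd⁺? r (rung x J t) ⟧

  -- The identity holds position by position. At (a + 1 , b) the outer indicator is that of
  -- `r (suc a) ≡ b`, and the inner one, taken at the diagonal successor of the removable box, is
  -- that of `r a ≡ b`, each diminished by the case that both rows have length b. Column 0 fits in,
  -- because `r a ≡ 0` forces the next row to be empty.
  corners-rowEnds : ∀ {r} → Antitone r → ∀ x J → #outer r x J + #rowEnd⁺ r x J ≡ #inner⁺ r x J + #rowEnd r x J
  corners-rowEnds {r} anti x J =
    trans (sym (∑-+ (suc J) (λ t → ⟦ outer? r (rung x J t) ⟧) (λ t → ⟦ rowEnd⁺? r (rung x J t) ⟧)))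
    (trans (∑-cong (suc J) λ t _ → pointwise (rung x J t))
           (∑-+ (suc J) (λ t → ⟦ inner⁺? r (rung x J t) ⟧) (λ t → ⟦ rowEnd? r (rung x J t) ⟧)))
    where
    pointwise : ∀ p → ⟦ outer? r p ⟧ + ⟦ rowEnd⁺? r p ⟧ ≡ ⟦ inner⁺? r p ⟧ + ⟦ rowEnd? r p ⟧
    pointwise (zero , b) = ℕ.+-identityʳ _
    pointwise p@(suc a , zero) = go (r a ≟ 0)
      where
      go : Dec (r a ≡ 0) → ⟦ outer? r p ⟧ + ⟦ r a ≟ 0 ⟧ ≡ ⟦ r (suc a) ≟ 0 ⟧
      go (yes ra≡0) = trans
        (cong₂ _+_ (⟦⟧-no (outer? r p) λ (_ , 0<) → ℕ.<⇒≢ 0< (sym ra≡0)) (⟦⟧-yes (r a ≟ 0) ra≡0))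
        (sym (⟦⟧-yes (r (suc a) ≟ 0) (ℕ.n≤0⇒n≡0 (≤-trans (anti (ℕ.n≤1+n a)) (≤-reflexive ra≡0)))))
      go (no ra≢0) = trans
        (cong₂ _+_ (⟦⟧-cong (outer? r p) (r (suc a) ≟ 0) proj₁ λ h → h , ℕ.n≢0⇒n>0 ra≢0) (⟦⟧-no (r a ≟ 0) ra≢0))
        (ℕ.+-identityʳ _)
    pointwise p@(suc a , suc b) = go (r a ≟ suc b) (r (suc a) ≟ suc b)
      where
      step≤ = anti (ℕ.n≤1+n a)
      go : Dec (r a ≡ suc b) → Dec (r (suc a) ≡ suc b) →
           ⟦ outer? r p ⟧ + ⟦ r a ≟ suc b ⟧ ≡ ⟦ inner? r (a , b) ⟧ + ⟦ r (suc a) ≟ suc b ⟧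
      go (yes ra≡) (yes ra′≡) = trans
        (cong₂ _+_ (⟦⟧-no (outer? r p) λ (_ , lt) → ℕ.<⇒≢ lt (sym ra≡)) (⟦⟧-yes (r a ≟ suc b) ra≡))
        (sym (cong₂ _+_ (⟦⟧-no (inner? r (a , b)) λ (_ , ≤b) → ℕ.<-irrefl refl
            (≤-trans (≤-reflexive (sym ra′≡)) ≤b))
                        (⟦⟧-yes (r (suc a) ≟ suc b) ra′≡)))
      go (yes ra≡) (no ra′≢) = trans
        (cong₂ _+_ (⟦⟧-no (outer? r p) λ (_ , lt) → ℕ.<⇒≢ lt (sym ra≡)) (⟦⟧-yes (r a ≟ suc b) ra≡))
        (sym (cong₂ _+_ (⟦⟧-yes (inner? r (a , b)) (ra≡ , s≤s⁻¹ (ℕ.≤∧≢⇒< (≤-trans step≤ (≤-reflexive ra≡)) ra′≢)))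
                        (⟦⟧-no (r (suc a) ≟ suc b) ra′≢)))
      go (no ra≢) _ = trans
        (cong₂ _+_ (⟦⟧-cong (outer? r p) (r (suc a) ≟ suc b) proj₁
                     λ h → h , ℕ.≤∧≢⇒< (≤-trans (≤-reflexive (sym h)) step≤) (ra≢ ∘ sym))
                   (⟦⟧-no (r a ≟ suc b) ra≢))
        (trans (ℕ.+-comm _ 0) (cong (_+ ⟦ r (suc a) ≟ suc b ⟧) (sym (⟦⟧-no (inner? r (a , b)) (ra≢ ∘ proj₁)))))

  rowEnds-N : ∀ r x J → #rowEnd r x J + N r x J ≡ ∑ (suc J) (λ t → ⟦ J ∸ t ≤? r (x + t * m) ⟧)
  rowEnds-N r x J = trans (sym (∑-+ (suc J) (λ t → ⟦ rowEnd? r (rung x J t) ⟧) (λ t → ⟦ J ∸ t <? r (x + t * m) ⟧)))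
    (∑-cong (suc J) λ t _ → pointwise (r (x + t * m)) (J ∸ t))
    where
    pointwise : ∀ k b → ⟦ k ≟ b ⟧ + ⟦ b <? k ⟧ ≡ ⟦ b ≤? k ⟧
    pointwise k b = go (k ≟ b)
      where
      go : Dec (k ≡ b) → ⟦ k ≟ b ⟧ + ⟦ b <? k ⟧ ≡ ⟦ b ≤? k ⟧
      go (yes refl) = trans (cong₂ _+_ (⟦⟧-yes (k ≟ k) refl) (⟦⟧-no (k <? k) (ℕ.<-irrefl refl)))
          (sym (⟦⟧-yes (k ≤? k) ≤-refl))
      go (no k≢b) = cong₂ _+_ (⟦⟧-no (k ≟ b) k≢b) (⟦⟧-cong (b <? k) (b ≤? k) <⇒≤ λ b≤k → ℕ.≤∧≢⇒< b≤k (k≢b ∘ sym))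

  -- The inequality says that the left neighbour is a box, and the left neighbours form the ladder
  -- through (x , J). The lowest position is in column 0 and always counts, whence the 1. With
  -- `rowEnds-N`, the number of row ends becomes a difference of consecutive ladder sizes plus one.
  ≤-N : ∀ r x J → ∑ (suc (suc J)) (λ t → ⟦ suc J ∸ t ≤? r (x + t * m) ⟧) ≡ N r x J + 1
  ≤-N r x J = trans (∑-last (suc J) (λ t → ⟦ suc J ∸ t ≤? r (x + t * m) ⟧)) (cong₂ _+_
    (∑-cong (suc J) λ t t≤J → ⟦⟧-cong (suc J ∸ t ≤? r (x + t * m)) (J ∸ t <? r (x + t * m))
      (subst (_≤ r (x + t * m)) (ℕ.+-∸-assoc 1 (s≤s⁻¹ t≤J)))
      (subst (_≤ r (x + t * m)) (sym (ℕ.+-∸-assoc 1 (s≤s⁻¹ t≤J)))))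
    (⟦⟧-yes (suc J ∸ suc J ≤? r (x + suc J * m)) (≤-trans (≤-reflexive (ℕ.n∸n≡0 J)) z≤n)))

  module _ {r r′} (N≡ : ∀ {x} J → x < m → N r x J ≡ N r′ x J) where

    #rowEnd-cong : ∀ {x} J → x < m → #rowEnd r x J ≡ #rowEnd r′ x J
    #rowEnd-cong {x} J x<m = ℕ.+-cancelʳ-≡ (N r x J) _ _
      (trans (rowEnds-N r x J) (trans (upper J)
          (sym (trans (cong (#rowEnd r′ x J +_) (N≡ J x<m)) (rowEnds-N r′ x J)))))
      where
      upper : ∀ J → ∑ (suc J) (λ t → ⟦ J ∸ t ≤? r (x + t * m) ⟧) ≡ ∑ (suc J) (λ t → ⟦ J ∸ t ≤? r′ (x + t * m) ⟧)
      upper zero    = cong (_+ 0) (trans (⟦⟧-yes (0 ≤? r (x + 0 * m)) z≤n) (sym (⟦⟧-yes (0 ≤? r′ (x + 0 * m)) z≤n)))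
      upper (suc J) = trans (≤-N r x J) (trans (cong (_+ 1) (N≡ J x<m)) (sym (≤-N r′ x J)))

    -- The rung of (0 , suc J) without its top is the rung of (m ∸ 1 , J) moved down.

    #rowEnd⁺-cong : ∀ {x} J → x < m → #rowEnd⁺ r x J ≡ #rowEnd⁺ r′ x J
    #rowEnd⁺-cong {suc x} J       x<m = #rowEnd-cong J (<⇒≤ x<m)
    #rowEnd⁺-cong {zero}  zero    _   = refl
    #rowEnd⁺-cong {zero}  (suc J) 0<m = shift (pred m) (ℕ.suc-pred m)
      where
      shift : ∀ k → suc k ≡ m → #rowEnd⁺ r 0 (suc J) ≡ #rowEnd⁺ r′ 0 (suc J)
      shift k refl = #rowEnd-cong J ≤-refl

    corners-balanced : Antitone r → Antitone r′ → ∀ {x} J → x < m →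
                       #outer r x J + #inner⁺ r′ x J ≡ #outer r′ x J + #inner⁺ r x J
    corners-balanced anti anti′ {x} J x<m = ℕ.+-cancelʳ-≡ (#rowEnd⁺ r x J) _ _ (begin
      o + i′ + e           ≡⟨ swap o i′ e ⟩
      o + e + i′           ≡⟨ cong (_+ i′) (corners-rowEnds anti x J) ⟩
      i + f + i′           ≡⟨ swap′ i f i′ ⟩
      i′ + f + i           ≡⟨ cong (λ f → i′ + f + i) (#rowEnd-cong J x<m) ⟩
      i′ + f′ + i          ≡⟨ cong (_+ i) (corners-rowEnds anti′ x J) ⟨
      o′ + e′ + i          ≡⟨ cong (λ e → o′ + e + i) (#rowEnd⁺-cong J x<m) ⟨
      o′ + e + i           ≡⟨ swap o′ e i ⟩
      o′ + i + e           ∎)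
      where
      open ≡-Reasoning
      o  = #outer r x J
      o′ = #outer r′ x J
      i  = #inner⁺ r x J
      i′ = #inner⁺ r′ x J
      e  = #rowEnd⁺ r x J
      e′ = #rowEnd⁺ r′ x J
      f  = #rowEnd r x J
      f′ = #rowEnd r′ x J
      swap : ∀ a b c → a + b + c ≡ a + c + b
      swap = solve-∀
      swap′ : ∀ a b c → a + b + c ≡ c + b + a
      swap′ = solve-∀

  length-filter-map : ∀ {A B : Set} {P : B → Set} (P? : Decidable P) (f : A → B) xs →
                      length (filter P? (List.map f xs)) ≡ length (filter (P? ∘ f) xs)
  length-filter-map P? f []       = refl
  length-filter-map P? f (x ∷ xs) with P? (f x)
  ... | yes _ = cong suc (length-filter-map P? f xs)
  ... | no  _ = length-filter-map P? f xs

  module Signatures {i r w} (sig : IsSignature i r w) where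
    open IsSignature sig

    count-other : ∀ {s x J} → residue (suc m) (x , J) ≢ i → count (s , L (x , J)) (List.map toLetter w) ≡ 0
    count-other {s} {x} {J} res≢ = count-absent
        (All.map⁺ (All.tabulate λ {y} y∈ eq → res≢ (go y y∈ (cong proj₂ eq))))
      where
      go : ∀ y → y ∈ w → L (x , J) ≡ label y → residue (suc m) (x , J) ≡ i
      go (plus  , p)     y∈ eq = trans (residue-ladder {x , J} {p} eq) (proj₁ (sound y∈))
      go (minus , a , b) y∈ eq = trans (residue-ladder {x , J} {suc a , suc b} eq)
          (trans (residue-diagonal a b) (proj₁ (sound y∈)))

    module _ {x} J (x<m : x < m) (res : residue (suc m) (x , J) ≡ i) where

      private
        signed : Sign → Position → Sign × Position
        signed = _,_
        hit? : ∀ s (y : Sign × Position) → Dec (toLetter y ≡ (s , L (x , J)))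
        hit? s y = toLetter y ≟ᴸ (s , L (x , J))

      count-plus : count (plus , L (x , J)) (List.map toLetter w) ≡ #outer r x J
      count-plus = trans (length-filter-map (_≟ᴸ (plus , L (x , J))) toLetter w) (trans
        (unique-length (Unique.filter⁺ (hit? plus) unique)
          (Unique.map⁺ {f = signed plus} (cong proj₂) (Unique.filter⁺ (outer? r) (rungs-unique x J))) to from)
        (trans (length-map (signed plus) (filter (outer? r) (rungs x J)))
            (length-filter-applyUpTo (outer? r) (rung x J) (suc J))))
        where
        to : ∀ {y} → y ∈ filter (hit? plus) w → y ∈ List.map (signed plus) (filter (outer? r) (rungs x J))
        to {s , p} y∈ with y∈w , eq ← ∈-filter⁻ (hit? plus) {xs = w} y∈ with refl ← cong proj₁ eq =
          ∈-map⁺ (signed plus) (∈-filter⁺ (outer? r) (∈-rungs⁺ x<m (cong proj₂ eq)) (proj₂ (sound y∈w)))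
        from : ∀ {y} → y ∈ List.map (signed plus) (filter (outer? r) (rungs x J)) → y ∈ filter (hit? plus) w
        from y∈ with p , p∈ , refl ← ∈-map⁻ (signed plus) y∈
          with p∈rungs , outer ← ∈-filter⁻ (outer? r) {xs = rungs x J} p∈ =
          ∈-filter⁺ (hit? plus) (complete (trans (residue-ladder {p} {x , J} (∈-rungs⁻ p∈rungs)) res) outer)
            (cong (plus ,_) (∈-rungs⁻ p∈rungs))

      count-minus : count (minus , L (x , J)) (List.map toLetter w) ≡ #inner⁺ r x J
      count-minus = trans (length-filter-map (_≟ᴸ (minus , L (x , J))) toLetter w) (trans
        (sym (length-map down (filter (hit? minus) w))) (trans
        (unique-length (Unique.map⁺ down-injective (Unique.filter⁺ (hit? minus) unique))
          (Unique.map⁺ {f = signed minus} (cong proj₂) (Unique.filter⁺ (inner⁺? r) (rungs-unique x J))) to from)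
        (trans (length-map (signed minus) (filter (inner⁺? r) (rungs x J)))
            (length-filter-applyUpTo (inner⁺? r) (rung x J) (suc J)))))
        where
        down : Sign × Position → Sign × Position
        down (s , a , b) = s , suc a , suc b
        down-injective : ∀ {y z} → down y ≡ down z → y ≡ z
        down-injective refl = refl
        to : ∀ {y} → y ∈ List.map down (filter (hit? minus) w) → y ∈ List.map (signed minus)
            (filter (inner⁺? r) (rungs x J))
        to y∈ with (s , a , b) , z∈ , refl ← ∈-map⁻ down y∈
          with z∈w , eq ← ∈-filter⁻ (hit? minus) {xs = w} z∈ with refl ← cong proj₁ eq =
          ∈-map⁺ (signed minus) (∈-filter⁺ (inner⁺? r) (∈-rungs⁺ x<m (cong proj₂ eq)) (proj₂ (sound z∈w)))
        from : ∀ {y} → y ∈ List.map (signed minus) (filter (inner⁺? r) (rungs x J)) → y ∈ List.map down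
            (filter (hit? minus) w)
        from y∈ with p , p∈ , refl ← ∈-map⁻ (signed minus) y∈
          with p∈rungs , inner ← ∈-filter⁻ (inner⁺? r) {xs = rungs x J} p∈ = lower p inner (∈-rungs⁻ p∈rungs)
          where
          lower : ∀ p → Inner⁺ r p → L p ≡ L (x , J) → (minus , p) ∈ List.map down (filter (hit? minus) w)
          lower (suc a , suc b) inner eq = ∈-map⁺ down (∈-filter⁺ (hit? minus)
            (complete (trans (sym (residue-diagonal a b)) (trans (residue-ladder {suc a , suc b} {x , J} eq)
                res)) inner)
            (cong (minus ,_) eq))

  signatures-cancel : ∀ {i r r′ w w′} → Antitone r → Antitone r′ → (∀ {x} J → x < m → N r x J ≡ N r′ x J) →
                      IsSignature i r w → IsSignature i r′ w′ →
                      cancel (embed (List.map toLetter w)) ≡ cancel (embed (List.map toLetter w′))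
  signatures-cancel {i} {r} {r′} {w} {w′} anti anti′ N≡ sig sig′ =
    cancel-balanced (AllPairs.map⁺ S.sorted) (AllPairs.map⁺ S′.sorted) balanced
    where
    module S  where
      open IsSignature sig public
      open Signatures sig public
    module S′ where
      open IsSignature sig′ public
      open Signatures sig′ public
    balanced : Balanced (List.map toLetter w) (List.map toLetter w′)
    -- Division by m exhibits any number g as the number of the ladder through some (x , J) with x <
    -- m, so all labels are covered.
    balanced g with x , J , x<m , refl ← row-coordinates g rewrite ℕ.*-comm J m with residue (suc m) (x , J) ≟ i
    ... | yes res = trans (cong₂ _+_ (S.count-plus J x<m res) (S′.count-minus J x<m res))
                   (trans (corners-balanced N≡ anti anti′ J x<m)
                          (sym (cong₂ _+_ (S′.count-plus J x<m res) (S.count-minus J x<m res))))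
    ... | no res≢ = trans (cong₂ _+_ (S.count-other res≢) (S′.count-other res≢))
                   (sym (cong₂ _+_ (S′.count-other res≢) (S.count-other res≢)))

  -- Reading signs along an ordered list of positions.

  ∈-mapMaybe⁺ : ∀ {A B : Set} (f : A → Maybe B) {xs x y} → x ∈ xs → f x ≡ just y → y ∈ mapMaybe f xs
  ∈-mapMaybe⁺ f {x ∷ xs} (here refl) eq rewrite eq = here refl
  ∈-mapMaybe⁺ f {x ∷ xs} (there x∈)  eq with f x
  ... | just _  = there (∈-mapMaybe⁺ f x∈ eq)
  ... | nothing = ∈-mapMaybe⁺ f x∈ eq

  ∈-mapMaybe⁻ : ∀ {A B : Set} (f : A → Maybe B) xs {y} → y ∈ mapMaybe f xs → ∃ λ x → x ∈ xs × f x ≡ just y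
  ∈-mapMaybe⁻ f (x ∷ xs) y∈ with f x in eq
  ∈-mapMaybe⁻ f (x ∷ xs) (here refl) | just _  = x , here refl , eq
  ∈-mapMaybe⁻ f (x ∷ xs) (there y∈)  | just _  with x′ , x′∈ , eq′ ← ∈-mapMaybe⁻ f xs y∈ = x′ , there x′∈ , eq′
  ∈-mapMaybe⁻ f (x ∷ xs) y∈          | nothing with x′ , x′∈ , eq′ ← ∈-mapMaybe⁻ f xs y∈ = x′ , there x′∈ , eq′

  allPairs-mapMaybe : ∀ {A B : Set} {R : A → A → Set} {S : B → B → Set} (f : A → Maybe B) →
    (∀ {x y x′ y′} → R x y → f x ≡ just x′ → f y ≡ just y′ → S x′ y′) →
    ∀ {xs} → AllPairs R xs → AllPairs S (mapMaybe f xs)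
  allPairs-mapMaybe f R⇒S [] = []
  allPairs-mapMaybe f R⇒S {x ∷ xs} (Rx ∷ Rxs) with f x in eq
  ... | nothing = allPairs-mapMaybe f R⇒S Rxs
  ... | just _  = All.tabulate (λ y∈ → let z , z∈ , eq′ = ∈-mapMaybe⁻ f xs y∈ in R⇒S (All.lookup Rx z∈) eq eq′)
                ∷ allPairs-mapMaybe f R⇒S Rxs

  allPairs-map-∈ : ∀ {A : Set} {R S : A → A → Set} {xs} → (∀ {x y} → x ∈ xs → y ∈ xs → R x y → S x y) →
                   AllPairs R xs → AllPairs S xs
  allPairs-map-∈ f []         = []
  allPairs-map-∈ f (Rx ∷ Rxs) = All.tabulate (λ y∈ → f (here refl) (there y∈) (All.lookup Rx y∈))
                              ∷ allPairs-map-∈ (λ x∈ y∈ → f (there x∈) (there y∈)) Rxs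

  Lex : (R S : ℕ → ℕ → Set) → Position → Position → Set
  Lex R S (a , b) (a′ , b′) = R a a′ ⊎ (a ≡ a′ × S b b′)

  allPairs-cartesianProduct : ∀ {R S as bs} → AllPairs R as → AllPairs S bs → AllPairs (Lex R S)
      (cartesianProduct as bs)
  allPairs-cartesianProduct [] Sbs = []
  allPairs-cartesianProduct {R} {S} {a ∷ as} {bs} (Ra ∷ Ras) Sbs = AllPairs.++⁺
    (AllPairs.map⁺ (AllPairs.map (λ s → inj₂ (refl , s)) Sbs))
    (allPairs-cartesianProduct Ras Sbs)
    (All.map⁺ (All.tabulate λ _ → All.tabulate λ p∈ → inj₁ (All.lookup Ra (proj₁ (∈-cartesianProduct⁻ as bs p∈)))))

  module _ {μ} (μ-part : IsPartition μ) (i : ℕ) where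

    private r = rowLength μ

    mark-sound : ∀ {p s q} → mark (suc m) i μ p ≡ just (s , q) → p ≡ q × residue (suc m) q ≡ i × Marked r s q
    mark-sound {p} eq with residue (suc m) p ≟ i | addable? μ p | removable? μ p
    mark-sound refl | yes res | yes add | _       = refl , res , proj₁ (addable⇔outer μ-part _) add
    mark-sound refl | yes res | no _    | yes rem = refl , res , proj₁ (removable⇔inner μ-part _) rem

    mark-complete : ∀ {s p} → residue (suc m) p ≡ i → Marked r s p → mark (suc m) i μ p ≡ just (s , p)
    mark-complete {s} {p} res marked with residue (suc m) p ≟ i | addable? μ p | removable? μ p
    mark-complete {s}     res marked | no res≢ | _        | _        = contradiction res res≢
    mark-complete {plus}  res marked | yes _   | yes _    | _        = refl
    mark-complete {plus}  res marked | yes _   | no ¬add  | _        = contradiction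
        (proj₂ (addable⇔outer μ-part _) marked) ¬add
    -- `mark` tests addability before removability. A removable position fails the first test,
    -- because its row has length b + 1 and not b.
    mark-complete {minus} res marked | yes _   | yes add  | _        =
      contradiction (trans (sym (outer-row _ (proj₁ (addable⇔outer μ-part _) add))) (proj₁ marked))
          (ℕ.<⇒≢ (ℕ.n<1+n _))
    mark-complete {minus} res marked | yes _   | no _     | yes _    = refl
    mark-complete {minus} res marked | yes _   | no _     | no ¬rem  = contradiction
        (proj₂ (removable⇔inner μ-part _) marked) ¬rem

    rowLength≤sum : ∀ a → r a ≤ sum μ
    rowLength≤sum a = <-determines λ b h → ≤-<-trans (ℕ.m≤n+m b a) (row+column<sum (proj₂ μ-part) h)

    marked-bounded : ∀ {s a b} → Marked r s (a , b) → a ≤ length μ × b ≤ sum μ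
    marked-bounded {minus} {a} (eq , _) =
      <⇒≤ (row⇒<length μ (≤-reflexive (sym eq))) , <⇒≤ (≤-trans (≤-reflexive (sym eq)) (rowLength≤sum a))
    marked-bounded {plus} {zero}  eq       = z≤n , subst (_≤ sum μ) eq (rowLength≤sum 0)
    marked-bounded {plus} {suc a} (eq , <r) = row⇒<length μ <r , subst (_≤ sum μ) eq (rowLength≤sum (suc a))

    -- The two signatures differ only in the list of positions and its order `R`. Sortedness is
    -- isolated in `R⇒⊑`, which is where regularity or `Locked` enters.
    module Reading {R : Position → Position → Set} {ps : List Position}
      (pairs    : AllPairs R ps)
      (R⇒≢      : ∀ {p q} → R p q → p ≢ q)
      (covering : ∀ {s p} → Marked r s p → p ∈ ps)
      (R⇒⊑      : ∀ {s p t q} → residue (suc m) p ≡ residue (suc m) q → Marked r s p → Marked r t q →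
          R p q → (s , p) ⊑ᴸ (t , q))
      where

      word : Word
      word = mapMaybe (mark (suc m) i μ) ps

      ordered : AllPairs (λ y z → R (proj₂ y) (proj₂ z)) word
      ordered = allPairs-mapMaybe (mark (suc m) i μ) keep pairs
        where
        keep : ∀ {p q y z} → R p q → mark (suc m) i μ p ≡ just y → mark (suc m) i μ q ≡ just z →
            R (proj₂ y) (proj₂ z)
        keep Rpq eq eq′ with refl , _ ← mark-sound eq with refl , _ ← mark-sound eq′ = Rpq

      isSignature : IsSignature i r word
      isSignature = record
        { sound    = sound
        ; complete = λ {s} res marked → ∈-mapMaybe⁺ (mark (suc m) i μ) (covering {s} marked)
            (mark-complete {s} res marked)
        ; unique   = AllPairs.map (λ Ryz eq → R⇒≢ Ryz (cong proj₂ eq)) ordered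
        ; sorted   = allPairs-map-∈ (λ y∈ z∈ → R⇒⊑ (trans (proj₁ (sound y∈)) (sym (proj₁ (sound z∈))))
            (proj₂ (sound y∈)) (proj₂ (sound z∈))) ordered
        }
        where
        sound : ∀ {s p} → (s , p) ∈ word → residue (suc m) p ≡ i × Marked r s p
        sound y∈ with _ , _ , eq ← ∈-mapMaybe⁻ (mark (suc m) i μ) ps y∈ = proj₂ (mark-sound eq)

  -- Sortedness of the ladder reading and of the row reading.

  -- No hook length equals ℓ times the arm length: the last box (a , c) of a row and
  -- the first position (suc h , b) below a column, b < c, lie on different ladders.

  Locked : (ℕ → ℕ) → Set
  Locked r = ∀ a c h b → r a ≡ suc c → b < c → r (suc h) ≤ b → b < r h → L (a , c) ≢ L (suc h , b)

  locked-corners : ∀ {r} → Locked r → ∀ {p q} → Inner r p → Outer r q → L p ≡ L q → ¬ proj₁ p < proj₁ q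
  locked-corners locked {a , c} {suc h , b} (ra , _) (rh , b<) eq a<h =
    locked a c h b ra (L-reverse eq a<h) (≤-reflexive rh) b< eq

  LadderOrder : Position → Position → Set
  LadderOrder p q = L p < L q ⊎ (L p ≡ L q × proj₁ p < proj₁ q)

  RowOrder : Position → Position → Set
  RowOrder = Lex (λ a a′ → a′ < a) _<_

  module LadderSignature {μ} (μ-part : IsPartition μ) (locked : Locked (rowLength μ)) (i : ℕ) where

    private
      r = rowLength μ
      rectangle = cartesianProduct (upTo (suc (length μ))) (upTo (suc (sum μ)))
      ladders = upTo (suc (suc m * sum μ))
      ps = concatMap (positionsOnLadder (suc m) μ) ladders

      on-ladder : ∀ {k p} → p ∈ positionsOnLadder (suc m) μ k → L p ≡ k
      on-ladder {k} p∈ = proj₂ (∈-filter⁻ (λ p → L p ≟ k) {xs = rectangle} p∈)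

      ps-ordered : AllPairs LadderOrder ps
      ps-ordered = AllPairs.concat⁺
        (All.map⁺ (All.tabulate {xs = ladders} λ {k} _ → same-ladder k))
        (AllPairs.map⁺ (AllPairs.map later-ladder (upTo-ordered (suc (suc m * sum μ)))))
        where
        subst₂-< : ∀ {x y j k} → x ≡ j → y ≡ k → j < k → x < y
        subst₂-< refl refl h = h
        upTo-ordered : ∀ n → AllPairs _<_ (upTo n)
        upTo-ordered n = AllPairs.applyUpTo⁺₁ (λ j → j) n λ i<j _ → i<j
        within : ∀ {k p q} → p ∈ positionsOnLadder (suc m) μ k → q ∈ positionsOnLadder (suc m) μ k →
                 Lex _<_ _<_ p q → LadderOrder p q
        within p∈ q∈ (inj₁ lt)         = inj₂ (trans (on-ladder p∈) (sym (on-ladder q∈)) , lt)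
        within {p = a , b} {_ , b′} p∈ q∈ (inj₂ (refl , lt)) =
          contradiction (L-cancel {a} (trans (on-ladder p∈) (sym (on-ladder q∈)))) (ℕ.<⇒≢ lt)

        same-ladder : ∀ k → AllPairs LadderOrder (positionsOnLadder (suc m) μ k)
        same-ladder k = allPairs-map-∈ {R = Lex _<_ _<_} within (AllPairs.filter⁺ (λ p → L p ≟ k)
          (allPairs-cartesianProduct (upTo-ordered (suc (length μ))) (upTo-ordered (suc (sum μ)))))
        later-ladder : ∀ {j k} → j < k → All (λ p → All (LadderOrder p) (positionsOnLadder (suc m) μ k))
            (positionsOnLadder (suc m) μ j)
        later-ladder j<k = All.tabulate λ p∈ → All.tabulate λ q∈ → inj₁ (subst₂-< (on-ladder p∈) (on-ladder q∈) j<k)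

      covering : ∀ {s p} → Marked r s p → p ∈ ps
      covering {s} {p@(a , b)} marked with a≤ , b≤ ← marked-bounded μ-part i {s} marked =
        ∈-concat⁺′ (∈-filter⁺ (λ q → L q ≟ L p) (∈-cartesianProduct⁺ (∈-upTo⁺ (s≤s a≤)) (∈-upTo⁺ (s≤s b≤))) refl)
          (∈-map⁺ (positionsOnLadder (suc m) μ) (∈-upTo⁺ (s≤s (ℕ.+-mono-≤ (≤sum s marked) (ℕ.*-monoʳ-≤ m b≤)))))
        where
        row<sum : ∀ {a b} → b < r a → a < sum μ
        row<sum {a} {b} h = ≤-<-trans (ℕ.m≤m+n a b) (row+column<sum (proj₂ μ-part) h)
        ≤sum : ∀ s {a b} → Marked r s (a , b) → a ≤ sum μ
        ≤sum minus           (eq , _) = <⇒≤ (row<sum (≤-reflexive (sym eq)))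
        ≤sum plus  {zero}    _        = z≤n
        ≤sum plus  {suc a}   (_ , <r) = row<sum <r

      ladderOrder⇒⊑ : ∀ {s p t q} → residue (suc m) p ≡ residue (suc m) q → Marked r s p → Marked r t q →
                      LadderOrder p q → (s , p) ⊑ᴸ (t , q)
      ladderOrder⇒⊑ res mp mq (inj₁ lt)        = ⊑ᴸ-intro res (inj₁ lt)
      ladderOrder⇒⊑ {s} {p} {t} {q} res mp mq (inj₂ (eq , lt)) = ⊑ᴸ-intro res (inj₂ (eq , λ { (refl , refl) →
        locked-corners locked {p} {q} mp mq eq lt }))

      ladderOrder⇒≢ : ∀ {p q} → LadderOrder p q → p ≢ q
      ladderOrder⇒≢ (inj₁ lt)       refl = ℕ.<-irrefl refl lt
      ladderOrder⇒≢ (inj₂ (_ , lt)) refl = ℕ.<-irrefl refl lt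

    open Reading μ-part i ps-ordered ladderOrder⇒≢ (λ {s} → covering {s}) ladderOrder⇒⊑ public

  module RowSignature {μ} (μ-part : IsPartition μ) (regular : Regular (rowLength μ)) (i : ℕ) where

    private
      r = rowLength μ
      anti : Antitone r
      anti = rows-antitone μ-part
      ps = cartesianProduct (downFrom (suc (length μ))) (upTo (suc (sum μ)))

      ps-ordered : AllPairs RowOrder ps
      ps-ordered = allPairs-cartesianProduct
        (AllPairs.applyDownFrom⁺₁ (λ j → j) (suc (length μ)) λ j<i _ → j<i)
        (AllPairs.applyUpTo⁺₁ (λ j → j) (suc (sum μ)) λ i<j _ → i<j)

      covering : ∀ {s p} → Marked r s p → p ∈ ps
      covering {s} {p@(a , b)} marked with a≤ , b≤ ← marked-bounded μ-part i {s} marked =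
        ∈-cartesianProduct⁺ (∈-downFrom⁺ (s≤s a≤)) (∈-upTo⁺ (s≤s b≤))

      rowOrder⇒≢ : ∀ {p q} → RowOrder p q → p ≢ q
      rowOrder⇒≢ (inj₁ lt)       refl = ℕ.<-irrefl refl lt
      rowOrder⇒≢ (inj₂ (_ , lt)) refl = ℕ.<-irrefl refl lt

      -- Move the box (c , d) up its ladder into one of the rows x, …, x + m ∸ 1.

      box-before-gap : ∀ k {c d x y} → c ≡ k + x → d < r c → r x ≤ y → L (c , d) < L (x , y)
      box-before-gap k = go k k ≤-refl
        where
        go : ∀ n k → k ≤ n → ∀ {c d x y} → c ≡ k + x → d < r c → r x ≤ y → L (c , d) < L (x , y)
        go n k k≤n {c} {d} {x} {y} refl d<r rx≤y with m ≤? k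
        ... | no m≰k = begin-strict
          k + x + m * d   <⟨ ℕ.+-monoˡ-< (m * d) (ℕ.+-monoˡ-< x (ℕ.≰⇒> m≰k)) ⟩
          m + x + m * d   ≡⟨ lemma m x d ⟩
          x + m * suc d   ≤⟨ ℕ.+-monoʳ-≤ x (ℕ.*-monoʳ-≤ m (<-≤-trans d<r (≤-trans (anti (ℕ.m≤n+m x k)) rx≤y))) ⟩
          x + m * y       ∎
          where
          open ℕ.≤-Reasoning
          lemma : ∀ m x d → m + x + m * d ≡ x + m * suc d
          lemma = solve-∀
        go zero    k k≤n refl d<r rx≤y | yes m≤k = contradiction (≤-trans 0<m (≤-trans m≤k k≤n)) λ ()
        go (suc n) k k≤n {c} {d} {x} {y} refl d<r rx≤y | yes m≤k = ≤-<-trans (≤-reflexive L≡)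
          (go n (k ∸ m) (s≤s⁻¹ (<-≤-trans (ℕ.∸-monoʳ-< 0<m m≤k) k≤n)) refl
            (regular (k ∸ m + x) d (subst (λ a → d < r a) k+x≡ d<r)) rx≤y)
          where
          k+x≡ : k + x ≡ m + (k ∸ m + x)
          k+x≡ = trans (cong (_+ x) (sym (ℕ.m+[n∸m]≡n m≤k))) (ℕ.+-assoc m (k ∸ m) x)
          lemma : ∀ m a d → m + a + m * d ≡ a + m * suc d
          lemma = solve-∀
          L≡ : k + x + m * d ≡ k ∸ m + x + m * suc d
          L≡ = trans (cong (_+ m * d) k+x≡) (lemma m (k ∸ m + x) d)

      before : ∀ {c d x y} → x ≤ c → d < r c → r x ≤ y → L (c , d) < L (x , y)
      before {c} {x = x} x≤c = box-before-gap (c ∸ x) (sym (ℕ.m∸n+n≡m x≤c))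

      -- `before` compares with the first free position of a row, but a minus sits one column
      -- further left. This costs m in the ladder number, less than ℓ, and equality of the residues
      -- absorbs it.
      L≤ : ∀ {p x y} → residue (suc m) p ≡ residue (suc m) (x , y) → L p ≤ L (x , suc y) → L p ≤ L (x , y)
      L≤ {p} {x} {y} res le = ℕ.≮⇒≥ λ lt → ℕ.<⇒≱ (≤-<-trans le (lemma m x y)) (residue-gap {x , y} {p} (sym res) lt)
        where
        lemma : ∀ m x y → x + m * suc y < suc m + (x + m * y)
        lemma m x y = s≤s (≤-reflexive (eq m x y))
          where
          eq : ∀ m x y → x + m * suc y ≡ m + (x + m * y)
          eq = solve-∀

      ≤⇒ : ∀ {s p t q} → L p ≤ L q → ¬ (s ≡ minus × t ≡ plus) → L p < L q ⊎ (L p ≡ L q × ¬ (s ≡ minus × t ≡ plus))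
      ≤⇒ le ok with ℕ.m≤n⇒m<n∨m≡n le
      ... | inj₁ lt = inj₁ lt
      ... | inj₂ eq = inj₂ (eq , ok)

      rowOrder⇒⊑ : ∀ {s p t q} → residue (suc m) p ≡ residue (suc m) q → Marked r s p → Marked r t q →
                   RowOrder p q → (s , p) ⊑ᴸ (t , q)
      rowOrder⇒⊑ {minus} {c , d} {plus} {x , y} res (rc , _) mq (inj₁ x<c) =
        ⊑ᴸ-intro res (inj₁ (before (<⇒≤ x<c) (≤-reflexive (sym rc)) (≤-reflexive (outer-row x mq))))
      rowOrder⇒⊑ {minus} {c , d} {minus} {x , y} res (rc , _) (rx , _) (inj₁ x<c) =
        ⊑ᴸ-intro res (≤⇒ (L≤ {c , d} res (<⇒≤ (before (<⇒≤ x<c) (≤-reflexive (sym rc)) (≤-reflexive rx)))) λ ())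
      -- An addable position below row 0 has a box above it, with ladder number one less, so the
      -- strict bound for that box is a weak bound for the plus.
      rowOrder⇒⊑ {plus} {suc c , d} {plus} {x , y} res (_ , d<) mq (inj₁ (s≤s x≤c)) =
        ⊑ᴸ-intro {plus} {suc c , d} {plus} {x , y} res
            (≤⇒ {p = suc c , d} (before x≤c d< (≤-reflexive (outer-row x mq))) λ ())
      rowOrder⇒⊑ {plus} {suc c , d} {minus} {x , y} res (_ , d<) (rx , _) (inj₁ (s≤s x≤c)) =
        ⊑ᴸ-intro {plus} {suc c , d} {minus} {x , y} res
            (≤⇒ {p = suc c , d} (L≤ {suc c , d} res (before x≤c d< (≤-reflexive rx))) λ ())
      rowOrder⇒⊑ {plus} {a , b} {plus} {_ , b′} res mp mq (inj₂ (refl , b<b′)) =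
        contradiction (trans (sym (outer-row a mp)) (outer-row a mq)) (ℕ.<⇒≢ b<b′)
      rowOrder⇒⊑ {plus} {a , b} {minus} {_ , b′} res mp (ra , _) (inj₂ (refl , b<b′)) =
        contradiction (trans (sym (outer-row a mp)) ra) (ℕ.<⇒≢ (ℕ.m≤n⇒m≤1+n b<b′))
      rowOrder⇒⊑ {minus} {a , b} {plus} {_ , b′} res (ra , _) mq (inj₂ (refl , b<b′))
        with refl ← trans (sym ra) (outer-row a mq) = contradiction res (residue-adjacent a b)
      rowOrder⇒⊑ {minus} {a , b} {minus} {_ , b′} res (ra , _) (ra′ , _) (inj₂ (refl , b<b′)) =
        contradiction (ℕ.suc-injective (trans (sym ra) ra′)) (ℕ.<⇒≢ b<b′)

    open Reading μ-part i ps-ordered rowOrder⇒≢ (λ {s} → covering {s}) rowOrder⇒⊑ public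

  -- Comparing good signs through their labels.

  plusses-map : (f : Sign × Position → Sign × Position) (g : Position → Position) →
                (∀ p → f (plus , p) ≡ (plus , g p)) → (∀ p → proj₁ (f (minus , p)) ≡ minus) →
                ∀ w → plusses (List.map f w) ≡ List.map g (plusses w)
  plusses-map f g f⁺ f⁻ [] = refl
  plusses-map f g f⁺ f⁻ ((plus  , p) ∷ w) rewrite f⁺ p = cong (g p ∷_) (plusses-map f g f⁺ f⁻ w)
  plusses-map f g f⁺ f⁻ ((minus , p) ∷ w) with f (minus , p) | f⁻ p
  ... | minus , _ | refl = plusses-map f g f⁺ f⁻ w

  minusses-map : (f : Sign × Position → Sign × Position) (g : Position → Position) →
                 (∀ p → f (minus , p) ≡ (minus , g p)) → (∀ p → proj₁ (f (plus , p)) ≡ plus) →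
                 ∀ w → minusses (List.map f w) ≡ List.map g (minusses w)
  minusses-map f g f⁻ f⁺ [] = refl
  minusses-map f g f⁻ f⁺ ((minus , p) ∷ w) rewrite f⁻ p = cong (g p ∷_) (minusses-map f g f⁻ f⁺ w)
  minusses-map f g f⁻ f⁺ ((plus  , p) ∷ w) with f (plus , p) | f⁺ p
  ... | plus , _ | refl = minusses-map f g f⁻ f⁺ w

  cancel-map : (f : Sign × Position → Sign × Position) → (∀ x → proj₁ (f x) ≡ proj₁ x) →
               ∀ w → cancel (List.map f w) ≡ List.map f (cancel w)
  cancel-map f sign [] = refl
  cancel-map f sign (x ∷ w) = trans (cong (push (f x)) (cancel-map f sign w)) (push-map x (cancel w))
    where
    push-map : ∀ x w → push (f x) (List.map f w) ≡ List.map f (push x w)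
    push-map (plus , p) w with f (plus , p) | sign (plus , p)
    ... | plus , _ | refl = refl
    push-map (minus , p) [] with f (minus , p) | sign (minus , p)
    ... | minus , _ | refl = refl
    push-map (minus , p) ((plus , q) ∷ w) with f (minus , p) | sign (minus , p) | f (plus , q) | sign (plus , q)
    ... | minus , _ | refl | plus , _ | refl = refl
    push-map (minus , p) ((minus , q) ∷ w) with f (minus , p) | sign (minus , p) | f (minus , q) | sign (minus , q)
    ... | minus , _ | refl | minus , _ | refl = refl

  relabel : Sign × Position → Sign × Position
  relabel x = proj₁ x , (label x , 0)

  cancel-relabel : ∀ w → cancel (embed (List.map toLetter w)) ≡ List.map relabel (cancel w)
  cancel-relabel w = trans (cong cancel (sym (map-∘ w))) (cancel-map relabel (λ _ → refl) w)

  plusLabel minusLabel : Position → Position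
  plusLabel p        = L p , 0
  minusLabel (a , b) = L (suc a , suc b) , 0

  module _ {w w′} (same : cancel (embed (List.map toLetter w)) ≡ cancel (embed (List.map toLetter w′))) where

    private
      relabelled : List.map relabel (cancel w) ≡ List.map relabel (cancel w′)
      relabelled = trans (sym (cancel-relabel w)) (trans same (cancel-relabel w′))

    last-plus-label : Maybe.map plusLabel (last (plusses (cancel w))) ≡ Maybe.map plusLabel
        (last (plusses (cancel w′)))
    last-plus-label = trans (sym (via w)) (trans (cong (last ∘ plusses) relabelled) (via w′))
      where
      via : ∀ w → last (plusses (List.map relabel (cancel w))) ≡ Maybe.map plusLabel (last (plusses (cancel w)))
      via w = trans (cong last (plusses-map relabel plusLabel (λ _ → refl) (λ _ → refl) (cancel w)))
          (last-map plusLabel (plusses (cancel w)))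

    first-minus-label : Maybe.map minusLabel (head (minusses (cancel w))) ≡ Maybe.map minusLabel
        (head (minusses (cancel w′)))
    first-minus-label = trans (sym (via w)) (trans (cong (head ∘ minusses) relabelled) (via w′))
      where
      via : ∀ w → head (minusses (List.map relabel (cancel w))) ≡ Maybe.map minusLabel (head (minusses (cancel w)))
      via w = trans (cong head (minusses-map relabel minusLabel (λ _ → refl) (λ _ → refl) (cancel w)))
          (head-map (minusses (cancel w)))

  -- Labels around a good sign in a sorted word.

  allPairs-around : ∀ {A : Set} {R : A → A → Set} u {x v} → AllPairs R (u ++ x ∷ v) →
                    (∀ {y} → y ∈ u → R y x) × (∀ {y} → y ∈ v → R x y)
  allPairs-around []      (Rx ∷ _)  = (λ ()) , All.lookup Rx
  allPairs-around (z ∷ u) (Rz ∷ Rs) with left , right ← allPairs-around u Rs =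
    (λ { (here refl) → All.lookup Rz (∈-++⁺ʳ u (here refl)) ; (there y∈) → left y∈ }) , right

  allPairs-suffix : ∀ {A : Set} {R : A → A → Set} u {v} → AllPairs R (u ++ v) → AllPairs R v
  allPairs-suffix []      Rs       = Rs
  allPairs-suffix (_ ∷ u) (_ ∷ Rs) = allPairs-suffix u Rs

  -- The letter right after the good plus is a minus, and a minus sorted after a plus has a strictly
  -- larger label. So no later plus lies on the ladder of p, and the minus itself is returned for
  -- the study of a plus on a further ladder.
  plus-gap : ∀ u {v p q} → AllPairs _⊑ᴸ_ (u ++ (plus , p) ∷ v) → ¬ StartsWithPlus v → (plus , q) ∈ v →
             ∃ λ z → (minus , z) ∈ v × L p < label (minus , z) × label (minus , z) ≤ L q
  plus-gap u {(plus  , z) ∷ v} sorted v-ok q∈ = contradiction (z , v , refl) v-ok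
  plus-gap u {(minus , z) ∷ v} sorted v-ok (there q∈) with (p⊑z ∷ _) ∷ (z⊑ ∷ _) ← allPairs-suffix u sorted =
    z , here refl , plus⊑minus p⊑z , ⊑-label (All.lookup z⊑ q∈)

  -- The letter right before the good minus is a plus, and it separates the labels strictly.
  minus-gap : ∀ u {v p q} → AllPairs _⊑ᴸ_ (u ++ (minus , p) ∷ v) → ¬ EndsWithMinus u → (minus , q) ∈ u →
      label (minus , q) < label (minus , p)
  minus-gap u sorted u-ok q∈ with initLast u
  ... | u′ ∷ʳ′ (minus , z) = contradiction (u′ , z , refl) u-ok
  ... | u′ ∷ʳ′ (plus , z) with ∈-++⁻ u′ q∈
  ...   | inj₁ q∈u′ = ≤-<-trans
    (⊑-label (proj₁ (allPairs-around u′ (subst (AllPairs _⊑ᴸ_) (++-assoc u′ _ _) sorted)) q∈u′))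
    (plus⊑minus (proj₁ (allPairs-around (u′ ∷ʳ (plus , z)) sorted) (∈-++⁺ʳ u′ (here refl))))
  ...   | inj₂ (here ())

  ∈-after : ∀ {A : Set} {R : A → A → Set} u {x v y} → (∀ {y z} → R y z → ¬ R z y) → AllPairs R (u ++ x ∷ v) →
            y ∈ u ++ x ∷ v → R x y → y ∈ v
  ∈-after u asym pairs y∈ Rxy with ∈-++⁻ u y∈
  ... | inj₁ y∈u         = contradiction Rxy (asym (proj₁ (allPairs-around u pairs) y∈u))
  ... | inj₂ (here refl) = contradiction Rxy (asym Rxy)
  ... | inj₂ (there y∈v) = y∈v

  ∈-before : ∀ {A : Set} {R : A → A → Set} u {x v y} → (∀ {y z} → R y z → ¬ R z y) → AllPairs R (u ++ x ∷ v) →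
             y ∈ u ++ x ∷ v → R y x → y ∈ u
  ∈-before u asym pairs y∈ Ryx with ∈-++⁻ u y∈
  ... | inj₁ y∈u         = y∈u
  ... | inj₂ (here refl) = contradiction Ryx (asym Ryx)
  ... | inj₂ (there y∈v) = contradiction (proj₂ (allPairs-around u pairs) y∈v) (asym Ryx)

  ladderOrder-asym : ∀ {p q} → LadderOrder p q → ¬ LadderOrder q p
  ladderOrder-asym (inj₁ lt)       (inj₁ gt)       = ℕ.<-asym lt gt
  ladderOrder-asym (inj₁ lt)       (inj₂ (eq , _)) = ℕ.<⇒≢ lt (sym eq)
  ladderOrder-asym (inj₂ (eq , _)) (inj₁ gt)       = ℕ.<⇒≢ gt (sym eq)
  ladderOrder-asym (inj₂ (_ , lt)) (inj₂ (_ , gt)) = ℕ.<-asym lt gt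

  rowOrder-asym : ∀ {p q} → RowOrder p q → ¬ RowOrder q p
  rowOrder-asym (inj₁ lt)          (inj₁ gt)          = ℕ.<-asym lt gt
  rowOrder-asym (inj₁ lt)          (inj₂ (refl , _))  = ℕ.<-irrefl refl lt
  rowOrder-asym (inj₂ (refl , _))  (inj₁ gt)          = ℕ.<-irrefl refl gt
  rowOrder-asym (inj₂ (refl , lt)) (inj₂ (_ , gt))    = ℕ.<-asym lt gt

  -- Preservation of `Locked` and of regularity.

  L-suc : ∀ a b → L (a , suc b) ≡ m + L (a , b)
  L-suc a b = lemma m a b
    where
    lemma : ∀ m a b → a + m * suc b ≡ m + (a + m * b)
    lemma = solve-∀

  addsBox-≤ : ∀ {p r r⁺} → AddsBox p r r⁺ → ∀ x → r x ≤ r⁺ x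
  addsBox-≤ {a , b} (ra , r⁺a , other) x with x ≟ a
  ... | yes refl = ≤-trans (≤-reflexive ra) (≤-trans (ℕ.n≤1+n b) (≤-reflexive (sym r⁺a)))
  ... | no x≢a   = ≤-reflexive (sym (other x x≢a))

  addsBox-new : ∀ {p r r⁺} → AddsBox p r r⁺ → ∀ {x y} → y < r⁺ x → y < r x ⊎ (x , y) ≡ p
  addsBox-new {a , b} (refl , r⁺a , other) {x} {y} y< with x ≟ a
  ... | no x≢a = inj₁ (subst (y <_) (other x x≢a) y<)
  ... | yes refl with ℕ.m≤n⇒m<n∨m≡n (s≤s⁻¹ (subst (y <_) r⁺a y<))
  ...   | inj₁ lt   = inj₁ lt
  ...   | inj₂ refl = inj₂ refl

  -- A violation created by the new box p is a column below it on the ladder of p,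
  -- or a row above it whose end is on the next ladder.  In the first case p is not
  -- the lowest addable position of its ladder.  In the second case the row has an
  -- addable position on the next i-ladder, and no minus in between can cancel it.

  locked-addsBox : ∀ {i r r⁺ w p} → Antitone r → Locked r → IsSignature i r w →
                   AllPairs (λ y z → LadderOrder (proj₂ y) (proj₂ z)) w → LastPlus w p → AddsBox p r r⁺ → Locked r⁺
  locked-addsBox {i} {r} {r⁺} {p = p@(a₀ , q)} anti locked sig ordered (u , v , refl , v-ok)
      adds@(ra₀ , r⁺a₀ , other) = locked⁺
    where
    open IsSignature sig
    res-p : residue (suc m) p ≡ i
    res-p = proj₁ (sound (∈-++⁺ʳ u (here refl)))
    outer-p : Outer r p
    outer-p = proj₂ (sound (∈-++⁺ʳ u (here refl)))
    r≤ = addsBox-≤ adds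

    later : ∀ {s} → residue (suc m) s ≡ i → Outer r s → LadderOrder p s →
            ∃ λ z → residue (suc m) z ≡ i × Inner r z × L p < label (minus , z) × label (minus , z) ≤ L s
    later {s} res outer order =
      let s∈v = ∈-after u (λ {y} {z} → ladderOrder-asym {proj₂ y} {proj₂ z}) ordered
              (complete {plus} {s} res outer) order
          z , z∈v , lo , hi = plus-gap u sorted v-ok s∈v
          res-z , inner-z = sound {minus} {z} (∈-++⁺ʳ u (there z∈v))
      in z , res-z , inner-z , lo , hi

    lowest : ∀ {s} → Outer r s → L s ≡ L p → ¬ a₀ < proj₁ s
    lowest {s} outer eq lt =
      let _ , _ , _ , lo , hi = later {s} (trans (residue-ladder {s} {p} eq) res-p) outer (inj₂ (sym eq , lt))
      in ℕ.<⇒≱ lo (≤-trans hi (≤-reflexive eq))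

    no-longer-row : ∀ a c → r a ≡ suc c → q < c → L (a , c) ≢ suc (L p)
    no-longer-row a c ra q<c eq = conclude
      (later {a , suc c} (trans (residue-ladder {a , suc c} {suc a₀ , suc q} L-next)
          (trans (residue-diagonal a₀ q) res-p))
             (outer a ra a<a₀ eq) (inj₁ (subst (L p <_) (sym L-next′) (s≤s (ℕ.m≤n+m (L p) m)))))
      where
      L-next′ : L (a , suc c) ≡ suc m + L p
      L-next′ = trans (L-suc a c) (trans (cong (m +_) eq) (ℕ.+-suc m (L p)))
      L-next : L (a , suc c) ≡ L (suc a₀ , suc q)
      L-next = trans L-next′ (sym (L-diagonal a₀ q))
      a<a₀ : a < a₀
      a<a₀ = ℕ.≰⇒> λ a₀≤a → ℕ.<⇒≱ q<c
          (≤-trans (ℕ.n≤1+n c) (≤-trans (≤-reflexive (sym ra)) (≤-trans (anti a₀≤a) (≤-reflexive ra₀))))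
      outer : ∀ a → r a ≡ suc c → a < a₀ → L (a , c) ≡ suc (L p) → Outer r (a , suc c)
      outer zero    ra _         _  = ra
      outer (suc a) ra (s≤s a<) eq = ra , ℕ.≤∧≢⇒< (≤-trans (≤-reflexive (sym ra)) (anti (ℕ.n≤1+n a)))
        λ ra′ → row-above a₀ refl ra′
        where
        row-above : ∀ k → k ≡ a₀ → suc c ≡ r a → ⊥
        row-above zero    ()
        -- If row `a` were equally long, its last box would lie on the ladder of `p`. As `p` is
        -- directly below the foot of column `q`, the old diagram would already have a forbidden
        -- hook.
        row-above (suc k) refl ra′ =
          locked a c k q (sym ra′) q<c (≤-reflexive ra₀) (proj₂ outer-p) (ℕ.suc-injective eq)
      L-z : ∀ x y → L p < label (minus , (x , y)) → label (minus , (x , y)) ≤ L (a , suc c) →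
            residue (suc m) (x , y) ≡ i → L p ≡ L (x , y)
      -- The label of the minus exceeds L p and is at most L p + ℓ, so L (x , y) lies above L p - ℓ
      -- and not above L p; equal residues leave only L p.
      L-z x y lo hi res-z = ℕ.≤-antisym
        (ℕ.≮⇒≥ λ lt → ℕ.<⇒≱ (subst (L p <_) (L-diagonal x y) lo)
            (residue-gap {x , y} {p} (trans res-z (sym res-p)) lt))
        (ℕ.+-cancelˡ-≤ (suc m) _ _ (≤-trans (≤-reflexive (sym (L-diagonal x y)))
            (≤-trans hi (≤-reflexive L-next′))))
      conclude : ¬ ∃ λ z → residue (suc m) z ≡ i × Inner r z × L p < label (minus , z) × label (minus , z) ≤
          L (a , suc c)
      -- The minus is on the ladder of `p`, hence the position below it is on the ladder of (a , c).
      -- Row `a` and column `y` then form a forbidden hook of the old diagram, once `y < c` is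
      -- known.
      conclude ((x , y) , res-z , inner@(rx , rsx) , lo , hi) =
        locked a c x y ra y<c rsx (≤-reflexive (sym rx)) (trans eq (cong suc same-ladder))
        where
        same-ladder = L-z x y lo hi res-z
        y<c : y < c
        y<c with ℕ.<-cmp x a₀
        ... | tri< x<a₀ _ _ = contradiction x<a₀ (locked-corners locked {x , y} {p} inner outer-p (sym same-ladder))
        ... | tri≈ _ refl _ with refl ← L-cancel {x} {y} {q} (sym same-ladder) = contradiction
            (trans (sym ra₀) rx) (ℕ.<⇒≢ (ℕ.n<1+n q))
        ... | tri> _ _ a₀<x = ℕ.<-trans (L-reverse same-ladder a₀<x) q<c

    locked⁺ : Locked r⁺
    locked⁺ a c h b r⁺a b<c r⁺sh≤b b<r⁺h eq with a ≟ a₀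
    ... | yes refl with refl ← ℕ.suc-injective (trans (sym r⁺a) r⁺a₀) = gap-height (ℕ.m≤n⇒m<n∨m≡n rsh≤b)
      where
      rsh≤b = ≤-trans (r≤ (suc h)) r⁺sh≤b
      b<rh : b < r h
      b<rh with addsBox-new adds b<r⁺h
      ... | inj₁ lt   = lt
      ... | inj₂ refl = contradiction refl (ℕ.<⇒≢ b<c)
      a₀<sh : a₀ < suc h
      a₀<sh = ℕ.≰⇒> λ sh≤a₀ → ℕ.<⇒≱ b<c (≤-trans (≤-reflexive (sym ra₀)) (≤-trans (anti sh≤a₀) rsh≤b))
      lower : ∀ {b c} → r a₀ ≡ c → b < c → r (suc h) < b → b < r h → L (a₀ , c) ≢ L (suc h , b)
      -- Both ends move one column to the left and still share a ladder: the old row `a₀` is one box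
      -- shorter, and column b, the one left of the original, also has its foot in row `h`.
      lower {suc b} {suc c} ra (s≤s b<c) (s≤s rsh≤b) b<rh eq = locked a₀ c h b ra b<c rsh≤b (<⇒≤ b<rh)
        (ℕ.+-cancelˡ-≡ m _ _ (trans (sym (L-suc a₀ c)) (trans eq (L-suc (suc h) b))))
      gap-height : r (suc h) < b ⊎ r (suc h) ≡ b → ⊥
      gap-height (inj₁ lt)  = lower ra₀ b<c lt b<rh eq
      gap-height (inj₂ rsh) = lowest {suc h , b} (rsh , b<rh) (sym eq) a₀<sh
    locked⁺ a c h b r⁺a b<c r⁺sh≤b b<r⁺h eq | no a≢a₀ with addsBox-new adds b<r⁺h
    ... | inj₁ b<rh = locked a c h b (trans (sym (other a a≢a₀)) r⁺a) b<c (≤-trans (r≤ (suc h)) r⁺sh≤b) b<rh eq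
    ... | inj₂ refl = no-longer-row a c (trans (sym (other a a≢a₀)) r⁺a) b<c eq

  -- Only the new box (m + a , b) can break regularity, namely when row a has length b + 1. Then (a
  -- , b + 1) is addable, since regularity applied to the row above `p` makes row a - 1 long enough.
  -- It lies higher on the ladder of `p`, which is excluded.
  regular-addsBox : ∀ {r r⁺ p} → Antitone r → Regular r → Outer r p → AddsBox p r r⁺ →
                    (∀ {q} → Outer r q → L q ≡ L p → ¬ proj₁ q < proj₁ p) → Regular r⁺
  regular-addsBox {r} {r⁺} {p} anti regular outer-p adds highest a b b< with addsBox-new adds b<
  ... | inj₁ lt = <-≤-trans (regular a b lt) (addsBox-≤ adds a)
  ... | inj₂ refl = <-≤-trans (ℕ.≰⇒> not-end) (addsBox-≤ adds a)
    where
    a<m+a : a < m + a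
    a<m+a = ℕ.+-monoˡ-≤ a 0<m
    outer : ∀ a → Outer r (m + a , b) → r a ≡ suc b → Outer r (a , suc b)
    outer zero    _  ra = ra
    outer (suc a) op ra = ra , regular a b (outer-above anti op (≤-reflexive (sym (ℕ.+-suc m a))))
    not-end : ¬ r a ≤ suc b
    not-end le = highest {a , suc b} (outer a outer-p (ℕ.≤-antisym le (outer-above anti outer-p a<m+a)))
      (trans (L-suc a b) (sym (ℕ.+-assoc m a (m * b)))) a<m+a

  -- Removing (a , b + 1) breaks regularity only if (m + a , b) is a box. Regularity at rows a and a
  -- + 1 then makes this box removable, and it lies lower on the ladder of the removed one, which is
  -- excluded.
  regular-removesBox : ∀ {r r⁻ p} → Regular r → Inner r p → AddsBox p r⁻ r →
                       (∀ {q} → Inner r q → L q ≡ L p → ¬ proj₁ p < proj₁ q) → Regular r⁻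
  regular-removesBox {r} {r⁻} {p@(a₀ , b₀)} regular (ra₀ , rsa₀) adds@(r⁻a₀ , _ , other) lowest a b b<
    with b<r ← <-≤-trans b< (addsBox-≤ adds (m + a)) with addsBox-new adds (regular a b b<r)
  ... | inj₁ lt   = lt
  ... | inj₂ refl = contradiction (ℕ.+-monoˡ-≤ a 0<m) (lowest {m + a , b}
      (ℕ.≤-antisym (ℕ.≮⇒≥ λ lt → ℕ.<⇒≱ (regular a (suc b) lt) (≤-reflexive ra₀)) b<r
      , ℕ.≮⇒≥ λ lt → ℕ.<⇒≱ (regular (suc a) b (subst (λ k → b < r k) (sym (ℕ.+-suc m a)) lt)) rsa₀)
      (trans (ℕ.+-assoc m a (m * b)) (sym (L-suc a b))))

  -- Commutation with the crystal operators.

  map-commute : ∀ {A B C D : Set} {label : A → D} {f : A → B} {g : A → C} {h : B → C} (x y : Maybe A) →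
                Maybe.map label x ≡ Maybe.map label y →
                (∀ {p q} → x ≡ just p → y ≡ just q → label p ≡ label q → h (f p) ≡ g q) →
                Maybe.map h (Maybe.map f x) ≡ Maybe.map g y
  map-commute nothing  nothing  _  _ = refl
  map-commute (just p) (just q) eq k = cong just (k refl refl (just-injective eq))

  map-just : ∀ {A B : Set} {f : A → B} {y} (x : Maybe A) → Maybe.map f x ≡ just y → ∃ λ p → x ≡ just p × f p ≡ y
  map-just (just p) refl = p , refl , refl

  module Commutation {μ} (μ-part : IsPartition μ) (locked : Locked (rowLength μ)) (i : ℕ) where

    private
      ν = ℛ (suc m) μ
      r = rowLength μ
      s = rowLength ν
      module R = Regularization μ-part
      module W = LadderSignature μ-part locked i
      module V = RowSignature R.ℛ-isPartition R.ℛ-regular i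
      open IsSignature

      words : cancel (embed (List.map toLetter W.word)) ≡ cancel (embed (List.map toLetter V.word))
      words = signatures-cancel (rows-antitone μ-part) (rows-antitone R.ℛ-isPartition)
                (λ J x<m → sym (R.ℛ-N J x<m)) W.isSignature V.isSignature

      last-sound : ∀ {r w p} → IsSignature i r w → LastPlus w p → Outer r p
      last-sound sig (u , _ , refl , _) = proj₂ (sound sig (∈-++⁺ʳ u (here refl)))

      first-sound : ∀ {r w p} → IsSignature i r w → FirstMinus w p → Inner r p
      first-sound sig (u , _ , refl , _) = proj₂ (sound sig (∈-++⁺ʳ u (here refl)))

      adds-box : ∀ {μ p} → Outer (rowLength μ) p → AddsBox p (rowLength μ) (rowLength (addToRow (proj₁ p) μ))
      adds-box {μ} {a , b} outer with refl ← outer-row a outer = addToRow-addsBox a μ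

      removes-box : ∀ {μ p} → Inner (rowLength μ) p → AddsBox p (rowLength (removeFromRow (proj₁ p) μ))
          (rowLength μ)
      removes-box {μ} {a , b} (eq , _) = removeFromRow-addsBox a μ eq

      last-highest : ∀ {w p} → IsSignature i s w → AllPairs (λ y z → RowOrder (proj₂ y) (proj₂ z)) w →
          LastPlus w p →
                     ∀ {q} → Outer s q → L q ≡ L p → ¬ proj₁ q < proj₁ p
      last-highest {p = p} sig ordered (u , v , refl , v-ok) {q} outer eq lt =
        let res = trans (residue-ladder {q} {p} eq) (proj₁ (sound sig {plus} {p} (∈-++⁺ʳ u (here refl))))
            q∈v = ∈-after u (λ {y} {z} → rowOrder-asym {proj₂ y} {proj₂ z}) ordered
                    (complete sig {plus} {q} res outer) (inj₁ lt)
            _ , _ , lo , hi = plus-gap u (sorted sig) v-ok q∈v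
        in ℕ.<⇒≱ lo (≤-trans hi (≤-reflexive eq))

      first-lowest : ∀ {w p} → IsSignature i s w → AllPairs (λ y z → RowOrder (proj₂ y) (proj₂ z)) w →
          FirstMinus w p →
                     ∀ {q} → Inner s q → L q ≡ L p → ¬ proj₁ p < proj₁ q
      first-lowest {p = p@(c , d)} sig ordered (u , v , refl , u-ok , _) {q@(a , b)} inner eq lt =
        let res = trans (residue-ladder {q} {p} eq) (proj₁ (sound sig {minus} {p} (∈-++⁺ʳ u (here refl))))
            q∈u = ∈-before u (λ {y} {z} → rowOrder-asym {proj₂ y} {proj₂ z}) ordered
                    (complete sig {minus} {q} res inner) (inj₁ lt)
        in ℕ.<⇒≢ (minus-gap u (sorted sig) u-ok q∈u)
                (trans (L-diagonal a b) (trans (cong (_+_ (suc m)) eq) (sym (L-diagonal c d))))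

      ℛ-add : ∀ {p q} → LastPlus W.word p → LastPlus V.word q → L p ≡ L q → ℛ (suc m) (addToRow (proj₁ p) μ)
          ≡ addToRow (proj₁ q) ν
      ℛ-add {p} {q} lp lq eq = rows-injective R⁺.ℛ-isPartition ν⁺-part
          (regular-unique R⁺.ℛ-regular ν⁺-regular λ {x} J x<m →
        trans (R⁺.ℛ-N J x<m) (trans (N-addsBox (adds-box outer-p) x J) (trans
          (cong₂ _+_ (sym (R.ℛ-N J x<m)) (∑-hits-ladder {x} {J} {p} {q} x<m eq))
          (sym (N-addsBox (adds-box {ν} outer-q) x J)))))
        where
        outer-p = last-sound W.isSignature lp
        outer-q = last-sound V.isSignature lq
        μ⁺-part = proj₂ (proj₂ (addable⇔outer μ-part p) outer-p)
        ν⁺-part = proj₂ (proj₂ (addable⇔outer R.ℛ-isPartition q) outer-q)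
        ν⁺-regular = regular-addsBox (rows-antitone R.ℛ-isPartition) R.ℛ-regular outer-q
            (adds-box {ν} outer-q) (λ {q′} → last-highest V.isSignature V.ordered lq {q′})
        module R⁺ = Regularization μ⁺-part

      ℛ-remove : ∀ {p q} → FirstMinus W.word p → FirstMinus V.word q → L p ≡ L q →
                 ℛ (suc m) (removeFromRow (proj₁ p) μ) ≡ removeFromRow (proj₁ q) ν
      ℛ-remove {p} {q} fp fq eq = rows-injective R⁻.ℛ-isPartition ν⁻-part
          (regular-unique R⁻.ℛ-regular ν⁻-regular λ {x} J x<m →
        trans (R⁻.ℛ-N J x<m) (ℕ.+-cancelʳ-≡ (∑-hits x J q) _ _ (trans
          (cong (N (rowLength (removeFromRow (proj₁ p) μ)) x J +_) (sym (∑-hits-ladder {x} {J} {p} {q} x<m eq)))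
          (trans (sym (N-addsBox (removes-box {μ} inner-p) x J))
              (trans (sym (R.ℛ-N J x<m)) (N-addsBox (removes-box {ν} inner-q) x J))))))
        where
        inner-p = first-sound W.isSignature fp
        inner-q = first-sound V.isSignature fq
        μ⁻-part = proj₂ (proj₂ (removable⇔inner μ-part p) inner-p)
        ν⁻-part = proj₂ (proj₂ (removable⇔inner R.ℛ-isPartition q) inner-q)
        ν⁻-regular = regular-removesBox R.ℛ-regular inner-q (removes-box {ν} inner-q)
            (λ {q′} → first-lowest V.isSignature V.ordered fq {q′})
        module R⁻ = Regularization μ⁻-part

    ℛ-f : Maybe.map (ℛ (suc m)) (f̂ (suc m) i μ) ≡ f̃ (suc m) i ν
    ℛ-f = map-commute (last (plusses (cancel W.word))) (last (plusses (cancel V.word)))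
        (last-plus-label {W.word} {V.word} words)
      λ eq eq′ h → ℛ-add (last-plus W.word eq) (last-plus V.word eq′) (cong proj₁ h)

    ℛ-e : Maybe.map (ℛ (suc m)) (ê (suc m) i μ) ≡ ẽ (suc m) i ν
    ℛ-e = map-commute (head (minusses (cancel W.word))) (head (minusses (cancel V.word)))
        (first-minus-label {W.word} {V.word} words)
      λ { {a , b} {c , d} eq eq′ h → ℛ-remove (first-minus W.word eq) (first-minus V.word eq′)
        (ℕ.+-cancelˡ-≡ (suc m) _ _ (trans (sym (L-diagonal a b)) (trans (cong proj₁ h) (L-diagonal c d)))) }

    f̂-locked : ∀ {ν} → f̂ (suc m) i μ ≡ just ν → IsPartition ν × Locked (rowLength ν)
    f̂-locked eq = locked-result (map-just (last (plusses (cancel W.word))) eq)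
      where
      locked-result : ∀ {ν} → ∃ (λ p → last (plusses (cancel W.word)) ≡ just p × addToRow (proj₁ p) μ ≡ ν) →
                      IsPartition ν × Locked (rowLength ν)
      locked-result (p , eq′ , refl) = proj₂ (proj₂ (addable⇔outer μ-part p) outer)
        , locked-addsBox (rows-antitone μ-part) locked W.isSignature W.ordered lp (adds-box outer)
        where
        lp = last-plus W.word eq′
        outer = last-sound W.isSignature lp

  node-locked : ∀ {μ} → LadderNode (suc m) μ → IsPartition μ × Locked (rowLength μ)
  -- `Locked` is vacuous for the empty diagram, in which no row has a last box.
  node-locked ∅ = ([] , []) , λ _ _ _ _ ()
  node-locked (step _ node eq) with μ-part , locked ← node-locked node = Commutation.f̂-locked μ-part locked _ eq

theorem3p9p1p7 : (ℓ : ℕ) .{{_ : NonZero ℓ}} → 3 ≤ ℓ → (i : ℕ) → i < ℓ →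
    ((μ : List ℕ) → LadderNode ℓ μ → map (ℛ ℓ) (f̂ ℓ i μ) ≡ f̃ ℓ i (ℛ ℓ μ)) ×
    ((μ : List ℕ) → LadderNode ℓ μ → map (ℛ ℓ) (ê ℓ i μ) ≡ ẽ ℓ i (ℛ ℓ μ))
theorem3p9p1p7 (suc m@(suc _)) _ i _ =
    (λ μ node → let μ-part , locked = node-locked m node in Commutation.ℛ-f m μ-part locked i)
  , (λ μ node → let μ-part , locked = node-locked m node in Commutation.ℛ-e m μ-part locked i)
theorem3p9p1p7 (suc zero) (s≤s ()) _ _
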